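{- We have the following equality of bigraded subspaces of $\mathfrak{Lie}(X)$: \[ \mathfrak{stab}_{\mathfrak{Lie}(X)}(\Delta_Y)=\mathfrak{ls}\oplus\mathbb{Q}x_0\oplus\mathbb{Q}x_1 . \]
   Context: Let $\mathbb{Q}\langle X\rangle$ be the free associative $\mathbb{Q}$-algebra on $X=\{x_0,x_1\}$, with coproduct $\Delta_X$ the algebra morphism given by $\Delta_X(x_i)=x_i\otimes1+1\otimes x_i$. Let $\mathfrak{Lie}(X)$ be the free Lie algebra on $X$, identified with the set of $\Delta_X$-primitive elements of $\mathbb{Q}\langle X\rangle$; it is bigraded by weight and depth, with $x_0$ of bidegree $(1,0)$ and $x_1$ of bidegree $(1,1)$. Let $\mathbb{Q}\langle Y\rangle$ be the free associative algebra on $Y=\{y_1,y_2,\dots\}$ with coproduct $\Delta_Y$ the algebra morphism with $\Delta_Y(y_n)=y_n\otimes1+1\otimes y_n$, and let $\mathfrak{Lie}(Y)$ be its set of $\Delta_Y$-primitive elements. Identify $\mathbb{Q}\langle Y\rangle$ with a subalgebra of $\mathbb{Q}\langle X\rangle$ via the injective algebra morphism $y_n\mapsto x_0^{n-1}x_1$. Let $\pi_Y:\mathbb{Q}\langle X\rangle\to\mathbb{Q}\langle Y\rangle$ be the linear map sending $x_0^{k_1-1}x_1\cdots x_0^{k_d-1}x_1x_0^r$ to $y_{k_1}\cdots y_{k_d}$ if $r=0$ and to $0$ if $r>0$. For a word $w$, $(\psi\mid w)$ denotes the coefficient of $w$ in $\psi$. For $\psi\in\mathbb{Q}\langle X\rangle$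 let $d_\psi$ be the derivation of $\mathbb{Q}\langle X\rangle$ with $d_\psi(x_0)=0$, $d_\psi(x_1)=[x_1,\psi]$. The Ihara bracket $\{\psi_1,\psi_2\}=d_{\psi_1}(\psi_2)-d_{\psi_2}(\psi_1)+[\psi_1,\psi_2]$ is a Lie bracket on $\mathfrak{Lie}(X)$. For $\psi\in\mathfrak{Lie}(X)$ put $s_\psi=\ell_\psi+d_\psi$ where $\ell_\psi$ is left multiplication by $\psi$; $s_\psi$ maps $\mathbb{Q}\langle X\rangle x_0$ into itself, so there is a unique linear map $s^Y_\psi:\mathbb{Q}\langle Y\rangle\to\mathbb{Q}\langle Y\rangle$ with $\pi_Y\circ s_\psi=s^Y_\psi\circ\pi_Y$. Define $\mathfrak{stab}_{\mathfrak{Lie}(X)}(\Delta_Y)=\{\psi\in\mathfrak{Lie}(X)\mid (s^Y_\psi\otimes\mathrm{id}+\mathrm{id}\otimes s^Y_\psi)\circ\Delta_Y=\Delta_Y\circ s^Y_\psi\}$. Let $\mathfrak{ls}$ be the set of $\psi\in\mathbb{Q}\langle X\rangle$ such that (i) $(\psi\mid x_i)=0$ for $i=0,1$; (ii) $\Delta_X(\psi)=\psi\otimes1+1\otimes\psi$; (iii) $\Delta_Y(\pi_Y(\psi))=\pi_Y(\psi)\otimes1+1\otimes\pi_Y(\psi)$; (iv) $(\psi\mid x_0^{n-1}x_1)=0$ for all even $n\ge2$. -}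

module Defs where

open import Data.Rational using (ℚ; 0ℚ; 1ℚ; _+_; _*_; -_)
open import Data.Nat as ℕ using (ℕ; zero; suc)
open import Data.List using (List; []; _∷_; _++_; map; concatMap; replicate)
open import Data.Product using (_×_; _,_)
open import Data.Maybe using (Maybe; just; nothing)
open import Relation.Binary.PropositionalEquality using (_≡_; refl)
open import Relation.Nullary using (yes; no)
open import Relation.Binary.Definitions using (DecidableEquality)
import Data.List.Properties as LP
import Data.Product.Properties as PP

-- Finite formal ℚ-linear combinations of elements of a basis B.
-- An element is represented by a list of (coefficient , basis element);
-- two representations are identified when all coefficients agree.

Lin : Set → Set
Lin B = List (ℚ × B)

coeff : {B : Set} → DecidableEquality B → Lin B → B → ℚ
coeff eq [] b = 0ℚ
coeff eq ((c , b') ∷ p) b with eq b' b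
... | yes _ = c + coeff eq p b
... | no  _ = coeff eq p b

scale : {B : Set} → ℚ → Lin B → Lin B
scale a = map (λ { (c , b) → (a * c , b) })

extend : {B C : Set} → (B → Lin C) → Lin B → Lin C
extend f = concatMap (λ { (c , b) → scale c (f b) })

-- Free associative algebra ℚ⟨A⟩ (basis: words) and its tensor square
-- ℚ⟨A⟩ ⊗ ℚ⟨A⟩ (basis: pairs of words).

Poly : Set → Set
Poly A = Lin (List A)

Tensor : Set → Set
Tensor A = Lin (List A × List A)

module FreeAlg {A : Set} (_≟A_ : DecidableEquality A) where

  wordEq : DecidableEquality (List A)
  wordEq = LP.≡-dec _≟A_

  pairEq : DecidableEquality (List A × List A)
  pairEq = PP.≡-dec wordEq wordEq

  coef : Poly A → List A → ℚ
  coef = coeff wordEq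

  coef₂ : Tensor A → List A × List A → ℚ
  coef₂ = coeff pairEq

  _≈_ : Poly A → Poly A → Set
  p ≈ q = ∀ w → coef p w ≡ coef q w

  _≈₂_ : Tensor A → Tensor A → Set
  s ≈₂ t = ∀ uv → coef₂ s uv ≡ coef₂ t uv

  word : List A → Poly A
  word w = (1ℚ , w) ∷ []

  _⊕_ : Poly A → Poly A → Poly A
  _⊕_ = _++_

  _⊖_ : Poly A → Poly A → Poly A
  p ⊖ q = p ++ scale (- 1ℚ) q

  mul : Poly A → Poly A → Poly A
  mul p q = concatMap (λ { (c , u) → map (λ { (d , v) → (c * d , u ++ v) }) q }) p

  -- coproduct Δ, the algebra morphism with every letter primitive:
  -- Δ(a w) = (a⊗1 + 1⊗a) Δ(w), Δ(empty word) = 1⊗1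
  Δword : List A → Tensor A
  Δword [] = (1ℚ , [] , []) ∷ []
  Δword (a ∷ w) = concatMap (λ { (c , u , v) → (c , a ∷ u , v) ∷ (c , u , a ∷ v) ∷ [] }) (Δword w)

  Δ : Poly A → Tensor A
  Δ = extend Δword

  prim : Poly A → Tensor A
  prim p = map (λ { (c , w) → (c , w , []) }) p ++ map (λ { (c , w) → (c , [] , w) }) p

  IsPrimitive : Poly A → Set
  IsPrimitive p = Δ p ≈₂ prim p

  _⊗id : (List A → Poly A) → Tensor A → Tensor A
  (S ⊗id) = extend (λ { (u , v) → map (λ { (c , u') → (c , u' , v) }) (S u) })

  id⊗_ : (List A → Poly A) → Tensor A → Tensor A
  id⊗ S = extend (λ { (u , v) → map (λ { (c , v') → (c , u , v') }) (S v) })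

data LetterX : Set where
  x₀ x₁ : LetterX

_≟X_ : DecidableEquality LetterX
x₀ ≟X x₀ = yes refl
x₀ ≟X x₁ = no λ ()
x₁ ≟X x₀ = no λ ()
x₁ ≟X x₁ = yes refl

-- The alphabet Y = {y₁ , y₂ , …}: the letter  n : ℕ  stands for  y_{n+1}.
LetterY : Set
LetterY = ℕ

module X = FreeAlg _≟X_
module Y = FreeAlg ℕ._≟_

PolyX = Poly LetterX
PolyY = Poly LetterY

-- the Lie algebra 𝔏𝔦𝔢(X) = Δ_X-primitive elements of ℚ⟨X⟩
IsLieX : PolyX → Set
IsLieX = X.IsPrimitive

ιword : List LetterY → List LetterX
ιword = concatMap (λ n → replicate n x₀ ++ x₁ ∷ [])

-- π_Y on words: x₀^{k₁-1}x₁ ⋯ x₀^{k_d-1}x₁ x₀^r ↦ y_{k₁}⋯y_{k_d} if r = 0, else 0.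
-- The first argument counts the pending x₀'s.
πword : ℕ → List LetterX → Maybe (List LetterY)
πword zero    [] = just []
πword (suc _) [] = nothing
πword n (x₀ ∷ w) = πword (suc n) w
πword n (x₁ ∷ w) with πword zero w
... | just v  = just (n ∷ v)
... | nothing = nothing

πY : PolyX → PolyY
πY = extend (λ w → f (πword zero w))
  where
  f : Maybe (List LetterY) → PolyY
  f (just v) = Y.word v
  f nothing  = []

dLetter : PolyX → LetterX → PolyX
dLetter ψ x₀ = []
dLetter ψ x₁ = X.mul (X.word (x₁ ∷ [])) ψ X.⊖ X.mul ψ (X.word (x₁ ∷ []))

dword : PolyX → List LetterX → PolyX
dword ψ [] = []
dword ψ (a ∷ w) = X.mul (dLetter ψ a) (X.word w) X.⊕ X.mul (X.word (a ∷ [])) (dword ψ w)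

dψ : PolyX → PolyX → PolyX
dψ ψ = extend (dword ψ)

sψ : PolyX → PolyX → PolyX
sψ ψ f = X.mul ψ f X.⊕ dψ ψ f

-- s^Y_ψ on basis words of ℚ⟨Y⟩.  Since π_Y ∘ ι = id, the unique linear map
-- with π_Y ∘ s_ψ = s^Y_ψ ∘ π_Y is s^Y_ψ = π_Y ∘ s_ψ ∘ ι.
sYψ : PolyX → List LetterY → PolyY
sYψ ψ v = πY (sψ ψ (X.word (ιword v)))

InStab : PolyX → Set
InStab ψ = IsLieX ψ ×
  (∀ (v : List LetterY) →
     ((sYψ ψ Y.⊗id) (Y.Δword v) ++ (Y.id⊗ sYψ ψ) (Y.Δword v)) Y.≈₂ Y.Δ (sYψ ψ v))

InLS : PolyX → Set
InLS ψ =
  (X.coef ψ (x₀ ∷ []) ≡ 0ℚ) × (X.coef ψ (x₁ ∷ []) ≡ 0ℚ) ×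
  X.IsPrimitive ψ ×
  Y.IsPrimitive (πY ψ) ×
  (∀ (n : ℕ) → 2 ℕ.≤ n → n ℕ.% 2 ≡ 0 → X.coef ψ (replicate (n ℕ.∸ 1) x₀ ++ x₁ ∷ []) ≡ 0ℚ)

lsSum : PolyX → ℚ → ℚ → PolyX
lsSum φ a b = φ ++ (a , x₀ ∷ []) ∷ (b , x₁ ∷ []) ∷ []

{-# OPTIONS --safe #-}
module Submission where

-- Since d_ψ(x₁) = [x₁ , ψ], the sum s_ψ(x₀ⁿ⁻¹x₁ ⋯) telescopes and s^Y_ψ is right multiplication by
-- π_Y(ψ) plus the derivation y_n ↦ [ψ , x₀ⁿ⁻¹] x₁.  Hence ψ stabilises Δ_Y iff π_Y(ψ) and all
-- [ψ , x₀ᵐ] x₁ are Δ_Y-primitive.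
--
-- Let f(a₀ , … , a_d) be the coefficient in ψ of x₀^{a₀} x₁ ⋯ x₁ x₀^{a_d}.  Primitivity of π_Y(ψ) says
-- that f vanishes on proper shuffles of its first d arguments when a_d = 0.  As ψ vanishes on x₀ ш w,
-- the generating function of f is translation invariant, so a_d may be arbitrary; the antipode gives
-- the same with a₀ fixed instead.  Comparing the two relations for shuffling in a single letter yields
-- cyclic invariance f(c , a) = f(a , c) for d ≥ 2.  For d = 1 it says that f is symmetric, and by the
-- antipode this is exactly the vanishing of the even-weight coefficients.  Finally [ψ , x₀ᵐ] x₁ has
-- generating function (z_dᵐ − z₀ᵐ) f(z₀ , … , z_d), whose shuffle sums reduce to
-- f(c , a) − f(a , c), while m = 1 and d = 1 recover the parity condition from the stabiliser.

open import Defs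
open import Data.Rational using (ℚ; 0ℚ; 1ℚ; _+_; _*_; -_)
import Data.Rational as ℚ
import Data.Rational.Properties as ℚ
open import Data.Rational.Solver using (module +-*-Solver)
open +-*-Solver using (solve; con; _:+_; _:*_; :-_; _:=_)
open import Algebra.Properties.Group ℚ.+-0-group using (∙-cancelˡ; ∙-cancelʳ)
open import Data.Nat as ℕ using (ℕ; zero; suc)
import Data.Nat.Properties as ℕP
open import Data.List using (List; []; _∷_; [_]; _++_; _∷ʳ_; _ʳ++_; reverse; length; map; replicate; concatMap; initLast; _∷ʳ′_)
open import Data.List.Properties using (++-assoc; ++-identityʳ; ++-cancelˡ; ++-cancelʳ; ∷-injectiveʳ; ∷ʳ-injectiveʳ; length-++; length-replicate; unfold-reverse; reverse-++; reverse-involutive)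
open import Data.Maybe as Maybe using (just; nothing; maybe′)
open import Data.Maybe.Properties using (just-injective)
open import Data.Product using (_×_; _,_; proj₁; proj₂; Σ-syntax; ∃-syntax)
open import Data.Sum using (_⊎_; inj₁; inj₂)
open import Data.Empty using (⊥-elim)
open import Function using (_∘_)
open import Function.Bundles using (_⇔_; mk⇔; module Equivalence)
open import Relation.Nullary using (Dec; yes; no)
open import Relation.Binary.Definitions using (DecidableEquality)
open import Relation.Binary.PropositionalEquality using (_≡_; _≢_; refl; sym; trans; cong; cong₂; subst; module ≡-Reasoning)
open ≡-Reasoning

-- Elements are lists that count as equal when their coefficients agree, so Δ, π_Y and s_ψ are
-- handled through their transposes on arbitrary functions of words; `coeff⇒pair` and `pair⇒coeff`
-- translate to coefficients and back. Primitivity becomes vanishing on proper shuffles, and the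
-- rest is combinatorics of coefficient functions. The summands ℚx₀ and ℚx₁ come from length. Proper
-- shuffles have at least two letters and the parity condition starts at x₀x₁, so the remaining
-- conditions do not see one-letter words, and (i) selects the representative without linear part.
-- Freeing a_d uses characteristic zero: translation invariance expresses (k + 1) f(..., k + 1)
-- through values with last exponent k, and the induction divides by k + 1. Parity is a separate
-- condition because of depth 1: with one of the two arguments fixed, a single letter remains and
-- nothing can be shuffled, so the comparison that gives cyclicity in depth at least 2 has no
-- counterpart there.

private variable A B C : Set

+-interchange : ∀ a b c d → (a + b) + (c + d) ≡ (a + c) + (b + d)
+-interchange = solve 4 (λ a b c d → (a :+ b) :+ (c :+ d) := (a :+ c) :+ (b :+ d)) refl

+≡0⇒≡- : ∀ {a b} → a + b ≡ 0ℚ → a ≡ - b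
+≡0⇒≡- {a} {b} e = begin
  a               ≡⟨ solve 2 (λ a b → a := (a :+ b) :+ (:- b)) refl a b ⟩
  (a + b) + (- b) ≡⟨ cong (_+ (- b)) e ⟩
  0ℚ + (- b)      ≡⟨ ℚ.+-identityˡ _ ⟩
  - b             ∎

self-negative⇒≡0 : ∀ {a} → a ≡ - a → a ≡ 0ℚ
self-negative⇒≡0 {a} e = begin
  a                  ≡⟨ solve 1 (λ a → a := con ℚ.½ :* (a :+ a)) refl a ⟩
  ℚ.½ * (a + a)      ≡⟨ cong (λ z → ℚ.½ * (a + z)) e ⟩
  ℚ.½ * (a + (- a))  ≡⟨ cong (ℚ.½ *_) (ℚ.+-inverseʳ a) ⟩
  ℚ.½ * 0ℚ           ≡⟨ ℚ.*-zeroʳ ℚ.½ ⟩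
  0ℚ                 ∎

∷ʳ≢[] : ∀ (u : List A) {a} → u ∷ʳ a ≢ []
∷ʳ≢[] []      ()
∷ʳ≢[] (_ ∷ _) ()

reverse≢[] : ∀ {u : List A} → u ≢ [] → reverse u ≢ []
reverse≢[] {u = u} ne e = ne (trans (sym (reverse-involutive u)) (cong reverse e))

-- Shuffle sums and alternality

-- sh G u v is the sum of G over the shuffles of u and v.
sh : (List A → ℚ) → List A → List A → ℚ
sh G []      v       = G v
sh G (a ∷ u) []      = G (a ∷ u)
sh G (a ∷ u) (b ∷ v) = sh (G ∘ (a ∷_)) u (b ∷ v) + sh (G ∘ (b ∷_)) (a ∷ u) v

-- Alternality in the sense of moulds. It leaves the value at the empty word free, so that value is
-- always controlled separately.
Alternal : (List A → ℚ) → Set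
Alternal G = ∀ u v → u ≢ [] → v ≢ [] → sh G u v ≡ 0ℚ

sh-[]ʳ : ∀ (G : List A → ℚ) u → sh G u [] ≡ G u
sh-[]ʳ G []      = refl
sh-[]ʳ G (_ ∷ _) = refl

-- All shuffles of `u` and `v` have the same length. This lets an equality that holds only for
-- nonempty words, or only for words of length other than one, pass through `sh`.
sh-cong-length : ∀ {G H : List A → ℚ} u v →
  (∀ w → length w ≡ length u ℕ.+ length v → G w ≡ H w) → sh G u v ≡ sh H u v
sh-cong-length []      v       e = e v refl
sh-cong-length (a ∷ u) []      e = e (a ∷ u) (sym (ℕP.+-identityʳ _))
sh-cong-length (a ∷ u) (b ∷ v) e = cong₂ _+_
  (sh-cong-length u (b ∷ v) (λ w l → e (a ∷ w) (cong suc l)))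
  (sh-cong-length (a ∷ u) v (λ w l → e (b ∷ w) (trans (cong suc l) (sym (ℕP.+-suc (suc (length u)) (length v))))))

sh-cong : ∀ {G H : List A → ℚ} → (∀ w → G w ≡ H w) → ∀ u v → sh G u v ≡ sh H u v
sh-cong e u v = sh-cong-length u v (λ w _ → e w)

sh-+ : ∀ (G H : List A → ℚ) u v → sh (λ w → G w + H w) u v ≡ sh G u v + sh H u v
sh-+ G H []      v       = refl
sh-+ G H (a ∷ u) []      = refl
sh-+ G H (a ∷ u) (b ∷ v) = trans
  (cong₂ _+_ (sh-+ (G ∘ (a ∷_)) (H ∘ (a ∷_)) u (b ∷ v)) (sh-+ (G ∘ (b ∷_)) (H ∘ (b ∷_)) (a ∷ u) v))
  (+-interchange (sh (G ∘ (a ∷_)) u (b ∷ v)) (sh (H ∘ (a ∷_)) u (b ∷ v)) _ _)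

sh-* : ∀ c (G : List A → ℚ) u v → sh (λ w → c * G w) u v ≡ c * sh G u v
sh-* c G []      v       = refl
sh-* c G (a ∷ u) []      = refl
sh-* c G (a ∷ u) (b ∷ v) = trans
  (cong₂ _+_ (sh-* c (G ∘ (a ∷_)) u (b ∷ v)) (sh-* c (G ∘ (b ∷_)) (a ∷ u) v))
  (sym (ℚ.*-distribˡ-+ c _ _))

sh-0 : ∀ (G : List A → ℚ) → (∀ w → G w ≡ 0ℚ) → ∀ u v → sh G u v ≡ 0ℚ
sh-0 G e []      v       = e v
sh-0 G e (a ∷ u) []      = e (a ∷ u)
sh-0 G e (a ∷ u) (b ∷ v) = cong₂ _+_ (sh-0 _ (e ∘ (a ∷_)) u (b ∷ v)) (sh-0 _ (e ∘ (b ∷_)) (a ∷ u) v)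

alternal-0 : ∀ {G : List A → ℚ} → (∀ w → G w ≡ 0ℚ) → Alternal G
alternal-0 e u v _ _ = sh-0 _ e u v

alternal-cong : ∀ {G H : List A → ℚ} → (∀ w → G w ≡ H w) → Alternal H → Alternal G
alternal-cong e altH u v u≢ v≢ = trans (sh-cong e u v) (altH u v u≢ v≢)

-- `sh` recurses on first letters, but fixing the last exponent requires sorting shuffles by their
-- last letter. Induction on the first letters; the two sortings commute.
sh-∷ʳ : ∀ (G : List A → ℚ) u v a b →
  sh G (u ∷ʳ a) (v ∷ʳ b) ≡ sh (G ∘ (_∷ʳ a)) u (v ∷ʳ b) + sh (G ∘ (_∷ʳ b)) (u ∷ʳ a) v
sh-∷ʳ G [] [] a b = ℚ.+-comm (G (a ∷ b ∷ [])) (G (b ∷ a ∷ []))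
sh-∷ʳ G [] (y ∷ v) a b = begin
  p + sh (G ∘ (y ∷_)) [ a ] (v ∷ʳ b)                            ≡⟨ cong (p +_) (sh-∷ʳ (G ∘ (y ∷_)) [] v a b) ⟩
  p + (q + sh (G ∘ (y ∷_) ∘ (_∷ʳ b)) [ a ] v)                   ≡⟨ swap₁ p q _ ⟩
  q + (p + sh (G ∘ (y ∷_) ∘ (_∷ʳ b)) [ a ] v)                   ∎
  where
  p = G (a ∷ y ∷ v ∷ʳ b)
  q = G ((y ∷ v ∷ʳ b) ∷ʳ a)
  swap₁ : ∀ p q r → p + (q + r) ≡ q + (p + r)
  swap₁ = solve 3 (λ p q r → p :+ (q :+ r) := q :+ (p :+ r)) refl
sh-∷ʳ G (x ∷ u) [] a b = begin
  sh (G ∘ (x ∷_)) (u ∷ʳ a) [ b ] + p                            ≡⟨ cong (_+ p) (sh-∷ʳ (G ∘ (x ∷_)) u [] a b) ⟩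
  (s + sh (G ∘ (x ∷_) ∘ (_∷ʳ b)) (u ∷ʳ a) []) + p               ≡⟨ cong (λ z → (s + z) + p) (sh-[]ʳ (G ∘ (x ∷_) ∘ (_∷ʳ b)) (u ∷ʳ a)) ⟩
  (s + q) + p                                                   ≡⟨ swap₂ s q p ⟩
  (s + p) + q                                                   ∎
  where
  p = G (b ∷ x ∷ u ∷ʳ a)
  q = G ((x ∷ u ∷ʳ a) ∷ʳ b)
  s = sh (G ∘ (x ∷_) ∘ (_∷ʳ a)) u [ b ]
  swap₂ : ∀ p q r → (p + q) + r ≡ (p + r) + q
  swap₂ = solve 3 (λ p q r → (p :+ q) :+ r := (p :+ r) :+ q) refl
sh-∷ʳ G (x ∷ u) (y ∷ v) a b = trans
  (cong₂ _+_ (sh-∷ʳ (G ∘ (x ∷_)) u (y ∷ v) a b) (sh-∷ʳ (G ∘ (y ∷_)) (x ∷ u) v a b))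
  (+-interchange (sh (G ∘ (x ∷_) ∘ (_∷ʳ a)) u (y ∷ v ∷ʳ b)) (sh (G ∘ (x ∷_) ∘ (_∷ʳ b)) (u ∷ʳ a) (y ∷ v)) _ _)

sh-reverse : ∀ (G : List A → ℚ) u v → sh (G ∘ reverse) u v ≡ sh G (reverse u) (reverse v)
sh-reverse G []      v       = refl
sh-reverse G (a ∷ u) []      = sym (sh-[]ʳ G (reverse (a ∷ u)))
sh-reverse G (a ∷ u) (b ∷ v) = begin
  sh (G ∘ reverse ∘ (a ∷_)) u (b ∷ v) + sh (G ∘ reverse ∘ (b ∷_)) (a ∷ u) v
    ≡⟨ cong₂ _+_ (step a u (b ∷ v)) (step b (a ∷ u) v) ⟩
  sh (G ∘ (_∷ʳ a)) (reverse u) (reverse (b ∷ v)) + sh (G ∘ (_∷ʳ b)) (reverse (a ∷ u)) (reverse v)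
    ≡⟨ cong₂ (λ p q → sh (G ∘ (_∷ʳ a)) (reverse u) q + sh (G ∘ (_∷ʳ b)) p (reverse v)) (unfold-reverse a u) (unfold-reverse b v) ⟩
  sh (G ∘ (_∷ʳ a)) (reverse u) (reverse v ∷ʳ b) + sh (G ∘ (_∷ʳ b)) (reverse u ∷ʳ a) (reverse v)
    ≡⟨ sh-∷ʳ G (reverse u) (reverse v) a b ⟨
  sh G (reverse u ∷ʳ a) (reverse v ∷ʳ b)
    ≡⟨ cong₂ (sh G) (unfold-reverse a u) (unfold-reverse b v) ⟨
  sh G (reverse (a ∷ u)) (reverse (b ∷ v)) ∎
  where
  step : ∀ c u′ v′ → sh (G ∘ reverse ∘ (c ∷_)) u′ v′ ≡ sh (G ∘ (_∷ʳ c)) (reverse u′) (reverse v′)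
  step c u′ v′ = trans (sh-cong (λ w → cong G (unfold-reverse c w)) u′ v′) (sh-reverse (G ∘ (_∷ʳ c)) u′ v′)

-- Signs and the antipode

sgn : ℕ → ℚ
sgn zero    = 1ℚ
sgn (suc n) = - sgn n

sgn-+ : ∀ m n → sgn (m ℕ.+ n) ≡ sgn m * sgn n
sgn-+ zero    n = sym (ℚ.*-identityˡ _)
sgn-+ (suc m) n = trans (cong -_ (sgn-+ m n)) (ℚ.neg-distribˡ-* (sgn m) (sgn n))

-- Moving the first letters of q one at a time in front of a ∷ p changes the sign each time.
module _ {F : List A → ℚ} (alt : Alternal F) where

  antipode-step : ∀ a p q → sh (F ∘ (a ∷_)) p q ≡ sgn (length q) * F (q ʳ++ (a ∷ p))
  antipode-step a p []      = trans (sh-[]ʳ _ p) (sym (ℚ.*-identityˡ _))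
  antipode-step a p (b ∷ q) = begin
    sh (F ∘ (a ∷_)) p (b ∷ q)                  ≡⟨ +≡0⇒≡- (alt (a ∷ p) (b ∷ q) (λ ()) (λ ())) ⟩
    - sh (F ∘ (b ∷_)) (a ∷ p) q                ≡⟨ cong -_ (antipode-step b (a ∷ p) q) ⟩
    - (sgn (length q) * F (q ʳ++ (b ∷ a ∷ p))) ≡⟨ ℚ.neg-distribˡ-* (sgn (length q)) _ ⟩
    sgn (suc (length q)) * F (q ʳ++ (b ∷ a ∷ p)) ∎

  antipode : F [] ≡ 0ℚ → ∀ w → F w ≡ sgn (suc (length w)) * F (reverse w)
  -- At the empty word the formula reads F [] = - F [], which alternality alone does not give.
  antipode F0 []      rewrite F0 = refl
  antipode F0 (a ∷ w) = trans (antipode-step a [] w)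
    (cong (_* F (reverse (a ∷ w))) (solve 1 (λ s → s := :- (:- s)) refl (sgn (length w))))

weight : List ℕ → ℕ
weight []      = 0
weight (a ∷ w) = suc a ℕ.+ weight w

-- Every shuffle consists of the same letters, so its weight, and with it the sign, is constant over
-- the sum.
sh-sgn : ∀ G u v → sh (λ w → sgn (weight w) * G w) u v ≡ (sgn (weight u) * sgn (weight v)) * sh G u v
sh-sgn G []      v       = cong (_* G v) (sym (ℚ.*-identityˡ (sgn (weight v))))
sh-sgn G (a ∷ u) []      = cong (_* G (a ∷ u)) (sym (ℚ.*-identityʳ (sgn (weight (a ∷ u)))))
sh-sgn G (a ∷ u) (b ∷ v) = begin
  sh (λ w → sgn (weight (a ∷ w)) * G (a ∷ w)) u (b ∷ v) + sh (λ w → sgn (weight (b ∷ w)) * G (b ∷ w)) (a ∷ u) v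
    ≡⟨ cong₂ _+_ (step a u (b ∷ v)) (step b (a ∷ u) v) ⟩
  sgn (suc a) * ((sgn (weight u) * sgn (weight (b ∷ v))) * X) + sgn (suc b) * ((sgn (weight (a ∷ u)) * sgn (weight v)) * Y)
    ≡⟨ cong₂ (λ s t → sgn (suc a) * ((sgn (weight u) * t) * X) + sgn (suc b) * ((s * sgn (weight v)) * Y)) (sgn-+ (suc a) (weight u)) (sgn-+ (suc b) (weight v)) ⟩
  sgn (suc a) * ((sgn (weight u) * (sgn (suc b) * sgn (weight v))) * X) + sgn (suc b) * (((sgn (suc a) * sgn (weight u)) * sgn (weight v)) * Y)
    ≡⟨ solve 6 (λ α β p q x y → α :* ((p :* (β :* q)) :* x) :+ β :* (((α :* p) :* q) :* y) := ((α :* p) :* (β :* q)) :* (x :+ y)) refl (sgn (suc a)) (sgn (suc b)) (sgn (weight u)) (sgn (weight v)) X Y ⟩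
  ((sgn (suc a) * sgn (weight u)) * (sgn (suc b) * sgn (weight v))) * (X + Y)
    ≡⟨ cong₂ (λ s t → (s * t) * (X + Y)) (sgn-+ (suc a) (weight u)) (sgn-+ (suc b) (weight v)) ⟨
  (sgn (weight (a ∷ u)) * sgn (weight (b ∷ v))) * (X + Y) ∎
  where
  X = sh (G ∘ (a ∷_)) u (b ∷ v)
  Y = sh (G ∘ (b ∷_)) (a ∷ u) v
  step : ∀ c u′ v′ → sh (λ w → sgn (weight (c ∷ w)) * G (c ∷ w)) u′ v′
                   ≡ sgn (suc c) * ((sgn (weight u′) * sgn (weight v′)) * sh (G ∘ (c ∷_)) u′ v′)
  step c u′ v′ = begin
    sh (λ w → sgn (weight (c ∷ w)) * G (c ∷ w)) u′ v′
      ≡⟨ sh-cong (λ w → trans (cong (_* G (c ∷ w)) (sgn-+ (suc c) (weight w))) (ℚ.*-assoc (sgn (suc c)) (sgn (weight w)) _)) u′ v′ ⟩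
    sh (λ w → sgn (suc c) * (sgn (weight w) * G (c ∷ w))) u′ v′
      ≡⟨ sh-* (sgn (suc c)) _ u′ v′ ⟩
    sgn (suc c) * sh (λ w → sgn (weight w) * G (c ∷ w)) u′ v′
      ≡⟨ cong (sgn (suc c) *_) (sh-sgn (G ∘ (c ∷_)) u′ v′) ⟩
    sgn (suc c) * ((sgn (weight u′) * sgn (weight v′)) * sh (G ∘ (c ∷_)) u′ v′) ∎

-- Cancellation of boundary terms

-- In a shuffle of u and v the letter extracted at the end (for P) or at the start
-- (for Q) leaves a proper shuffle behind unless it was all of u or all of v.
module _ (P Q : List A → ℚ)
  (altP : ∀ a → Alternal (P ∘ (_∷ʳ a))) (altQ : ∀ a → Alternal (Q ∘ (a ∷_)))
  (cyclic : ∀ a w → w ≢ [] → P (w ∷ʳ a) ≡ Q (a ∷ w)) where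

  private
    -- The boundary term: it can survive only if `u` is one letter, whose extraction leaves all of
    -- `v` and no proper shuffle. Cyclicity allows it to be written with `Q` for both functions.
    single : List A → List A → ℚ
    single []          v = 0ℚ
    single (a ∷ [])    v = Q (a ∷ v)
    single (_ ∷ _ ∷ _) v = 0ℚ

    single-∷ʳ-∷ : ∀ x u a v → single (x ∷ u ∷ʳ a) v ≡ 0ℚ
    single-∷ʳ-∷ x []      a v = refl
    single-∷ʳ-∷ x (_ ∷ _) a v = refl

    firstTerm : ∀ a u v → v ≢ [] → sh (Q ∘ (a ∷_)) u v ≡ single (a ∷ u) v
    firstTerm a []      v v≢ = refl
    firstTerm a (x ∷ u) v v≢ = altQ a (x ∷ u) v (λ ()) v≢

    lastTerm : ∀ a u v → v ≢ [] → sh (P ∘ (_∷ʳ a)) u v ≡ single (u ∷ʳ a) v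
    lastTerm a []      v v≢ = cyclic a v v≢
    lastTerm a (x ∷ u) v v≢ = trans (altP a (x ∷ u) v (λ ()) v≢) (sym (single-∷ʳ-∷ x u a v))

    sh-comm : ∀ (G : List A → ℚ) u v → sh G u v ≡ sh G v u
    sh-comm G []      v       = sym (sh-[]ʳ G v)
    sh-comm G (a ∷ u) []      = refl
    sh-comm G (a ∷ u) (b ∷ v) = trans (ℚ.+-comm (sh (G ∘ (a ∷_)) u (b ∷ v)) _)
      (cong₂ _+_ (sh-comm (G ∘ (b ∷_)) (a ∷ u) v) (sh-comm (G ∘ (a ∷_)) u (b ∷ v)))

    shP : ∀ u v → u ≢ [] → v ≢ [] → sh P u v ≡ single u v + single v u
    shP u v u≢ v≢ with initLast u | initLast v
    ... | []      | _       = ⊥-elim (u≢ refl)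
    ... | _ ∷ʳ′ _ | []      = ⊥-elim (v≢ refl)
    ... | u ∷ʳ′ a | v ∷ʳ′ b = trans (sh-∷ʳ P u v a b)
      (cong₂ _+_ (lastTerm a u (v ∷ʳ b) v≢) (trans (sh-comm _ (u ∷ʳ a) v) (lastTerm b v (u ∷ʳ a) u≢)))

    shQ : ∀ u v → u ≢ [] → v ≢ [] → sh Q u v ≡ single u v + single v u
    shQ []      v       u≢ v≢ = ⊥-elim (u≢ refl)
    shQ (_ ∷ _) []      u≢ v≢ = ⊥-elim (v≢ refl)
    shQ (a ∷ u) (b ∷ v) u≢ v≢ =
      cong₂ _+_ (firstTerm a u (b ∷ v) v≢) (trans (sh-comm _ (a ∷ u) v) (firstTerm b v (a ∷ u) u≢))

  sh-cyclic : ∀ u v → u ≢ [] → v ≢ [] → sh P u v ≡ sh Q u v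
  sh-cyclic u v u≢ v≢ = trans (shP u v u≢ v≢) (sym (shQ u v u≢ v≢))

  -- Meant for the coefficients of ψ x₀ᵐ x₁ and x₀ᵐ ψ x₁. Neither has to be alternal by itself; both
  -- shuffle sums equal the same boundary terms.
  alternal-difference : Alternal (λ w → P w + (- 1ℚ) * Q w)
  alternal-difference u v u≢ v≢ = begin
    sh (λ w → P w + (- 1ℚ) * Q w) u v  ≡⟨ sh-+ P (λ w → (- 1ℚ) * Q w) u v ⟩
    sh P u v + sh (λ w → (- 1ℚ) * Q w) u v ≡⟨ cong₂ _+_ (sh-cyclic u v u≢ v≢) (sh-* (- 1ℚ) Q u v) ⟩
    sh Q u v + (- 1ℚ) * sh Q u v       ≡⟨ solve 1 (λ x → x :+ con (- 1ℚ) :* x := con 0ℚ) refl (sh Q u v) ⟩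
    0ℚ                                 ∎

-- Infinitesimal translation of coefficient functions

nat : ℕ → ℚ
nat zero    = 0ℚ
nat (suc n) = 1ℚ + nat n

nat≥0 : ∀ n → 0ℚ ℚ.≤ nat n
nat≥0 zero    = ℚ.≤-refl
nat≥0 (suc n) = ℚ.+-mono-≤ (ℚ.nonNegative⁻¹ 1ℚ) (nat≥0 n)

-- Undoes the integer factor that differentiating a power produces.
nat-suc-cancel : ∀ n {x} → nat (suc n) * x ≡ 0ℚ → x ≡ 0ℚ
nat-suc-cancel n {x} e = begin
  x               ≡⟨ ℚ.*-identityˡ x ⟨
  1ℚ * x          ≡⟨ cong (_* x) (ℚ.*-inverseˡ c) ⟨
  (ℚ.1/ c * c) * x ≡⟨ ℚ.*-assoc (ℚ.1/ c) c x ⟩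
  ℚ.1/ c * (c * x) ≡⟨ cong (ℚ.1/ c *_) e ⟩
  ℚ.1/ c * 0ℚ      ≡⟨ ℚ.*-zeroʳ (ℚ.1/ c) ⟩
  0ℚ              ∎
  where
  c = nat (suc n)
  instance
    c≢0 : ℚ.NonZero c
    c≢0 = ℚ.>-nonZero (ℚ.+-mono-<-≤ (ℚ.positive⁻¹ 1ℚ) (nat≥0 n))

-- On generating functions in commuting variables, inc is the sum of all partial derivatives.
inc : (List ℕ → ℚ) → List ℕ → ℚ
inc g []      = 0ℚ
inc g (a ∷ l) = nat (suc a) * g (suc a ∷ l) + inc (g ∘ (a ∷_)) l

-- `inc` preserves length and is zero at `[]`, so `g []` never enters. The same restriction in
-- `inc-0` keeps the words nonempty when alternality is applied to them in `sh-inc-0`.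
inc-cong : ∀ {g h} → (∀ a l → g (a ∷ l) ≡ h (a ∷ l)) → ∀ l → inc g l ≡ inc h l
inc-cong e []      = refl
inc-cong e (a ∷ l) = cong₂ _+_ (cong (nat (suc a) *_) (e (suc a) l)) (inc-cong (λ b m → e a (b ∷ m)) l)

inc-0 : ∀ {g} → (∀ a l → g (a ∷ l) ≡ 0ℚ) → ∀ l → inc g l ≡ 0ℚ
inc-0 e []      = refl
inc-0 e (a ∷ l) = cong₂ _+_ (trans (cong (nat (suc a) *_) (e (suc a) l)) (ℚ.*-zeroʳ (nat (suc a)))) (inc-0 (λ b m → e a (b ∷ m)) l)

inc-+ : ∀ g h l → inc (λ w → g w + h w) l ≡ inc g l + inc h l
inc-+ g h []      = refl
inc-+ g h (a ∷ l) = trans (cong (nat (suc a) * (g (suc a ∷ l) + h (suc a ∷ l)) +_) (inc-+ (g ∘ (a ∷_)) (h ∘ (a ∷_)) l))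
  (solve 5 (λ n p q r s → n :* (p :+ q) :+ (r :+ s) := (n :* p :+ r) :+ (n :* q :+ s)) refl
    (nat (suc a)) (g (suc a ∷ l)) (h (suc a ∷ l)) (inc (g ∘ (a ∷_)) l) (inc (h ∘ (a ∷_)) l))

inc-∷ʳ : ∀ g l k → inc g (l ∷ʳ k) ≡ inc (g ∘ (_∷ʳ k)) l + nat (suc k) * g (l ∷ʳ suc k)
inc-∷ʳ g []      k = ℚ.+-comm (nat (suc k) * g (suc k ∷ [])) 0ℚ
inc-∷ʳ g (a ∷ l) k = trans (cong (nat (suc a) * g (suc a ∷ l ∷ʳ k) +_) (inc-∷ʳ (g ∘ (a ∷_)) l k))
  (sym (ℚ.+-assoc (nat (suc a) * g (suc a ∷ l ∷ʳ k)) (inc (g ∘ (a ∷_) ∘ (_∷ʳ k)) l) _))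

-- Raising one letter of a shuffle amounts to raising one letter of `u` or of `v` and then
-- shuffling; the factor depends only on the raised letter.
sh-inc : ∀ g u v → sh (inc g) u v ≡ inc (λ u′ → sh g u′ v) u + inc (λ v′ → sh g u v′) v
sh-inc g []      v       = sym (ℚ.+-identityˡ (inc g v))
sh-inc g (a ∷ u) []      = trans (inc-cong {g} {λ u′ → sh g u′ []} (λ _ _ → refl) (a ∷ u))
  (sym (ℚ.+-identityʳ (inc (λ u′ → sh g u′ []) (a ∷ u))))
sh-inc g (a ∷ u) (b ∷ v) = begin
  sh (inc g ∘ (a ∷_)) u (b ∷ v) + sh (inc g ∘ (b ∷_)) (a ∷ u) v
    ≡⟨ cong₂ _+_ (step a u (b ∷ v)) (step b (a ∷ u) v) ⟩
  (α * A₁ + (inc (λ u′ → sh (g ∘ (a ∷_)) u′ (b ∷ v)) u + (β * B₁ + R₁)))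
    + (β * B₂ + ((α * A₂ + R₂) + inc (λ v′ → sh (g ∘ (b ∷_)) (a ∷ u) v′) v))
    ≡⟨ solve 10 (λ α β a₁ a₂ b₁ b₂ p q r₁ r₂ →
         (α :* a₁ :+ (p :+ (β :* b₁ :+ r₁))) :+ (β :* b₂ :+ ((α :* a₂ :+ r₂) :+ q))
         := (α :* (a₁ :+ a₂) :+ (p :+ r₂)) :+ (β :* (b₁ :+ b₂) :+ (r₁ :+ q))) refl
       α β A₁ A₂ B₁ B₂ (inc (λ u′ → sh (g ∘ (a ∷_)) u′ (b ∷ v)) u) (inc (λ v′ → sh (g ∘ (b ∷_)) (a ∷ u) v′) v) R₁ R₂ ⟩
  (α * (A₁ + A₂) + (inc (λ u′ → sh (g ∘ (a ∷_)) u′ (b ∷ v)) u + R₂))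
    + (β * (B₁ + B₂) + (R₁ + inc (λ v′ → sh (g ∘ (b ∷_)) (a ∷ u) v′) v))
    ≡⟨ cong₂ (λ p q → (α * (A₁ + A₂) + p) + (β * (B₁ + B₂) + q))
         (inc-+ (λ u′ → sh (g ∘ (a ∷_)) u′ (b ∷ v)) (λ u′ → sh (g ∘ (b ∷_)) (a ∷ u′) v) u)
         (inc-+ (λ v′ → sh (g ∘ (a ∷_)) u (b ∷ v′)) (λ v′ → sh (g ∘ (b ∷_)) (a ∷ u) v′) v) ⟨
  inc (λ u′ → sh g u′ (b ∷ v)) (a ∷ u) + inc (λ v′ → sh g (a ∷ u) v′) (b ∷ v) ∎
  where
  α = nat (suc a)
  β = nat (suc b)
  A₁ = sh (g ∘ (suc a ∷_)) u (b ∷ v)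
  A₂ = sh (g ∘ (b ∷_)) (suc a ∷ u) v
  B₁ = sh (g ∘ (a ∷_)) u (suc b ∷ v)
  B₂ = sh (g ∘ (suc b ∷_)) (a ∷ u) v
  R₁ = inc (λ v′ → sh (g ∘ (a ∷_)) u (b ∷ v′)) v
  R₂ = inc (λ u′ → sh (g ∘ (b ∷_)) (a ∷ u′) v) u
  step : ∀ c u′ v′ → sh (inc g ∘ (c ∷_)) u′ v′
       ≡ nat (suc c) * sh (g ∘ (suc c ∷_)) u′ v′ + (inc (λ u″ → sh (g ∘ (c ∷_)) u″ v′) u′ + inc (λ v″ → sh (g ∘ (c ∷_)) u′ v″) v′)
  step c u′ v′ = begin
    sh (inc g ∘ (c ∷_)) u′ v′
      ≡⟨ sh-+ (λ w → nat (suc c) * g (suc c ∷ w)) (inc (g ∘ (c ∷_))) u′ v′ ⟩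
    sh (λ w → nat (suc c) * g (suc c ∷ w)) u′ v′ + sh (inc (g ∘ (c ∷_))) u′ v′
      ≡⟨ cong₂ _+_ (sh-* (nat (suc c)) (g ∘ (suc c ∷_)) u′ v′) (sh-inc (g ∘ (c ∷_)) u′ v′) ⟩
    _ ∎

sh-inc-0 : ∀ {g} → Alternal g → ∀ u v → u ≢ [] → v ≢ [] → sh (inc g) u v ≡ 0ℚ
sh-inc-0 {g} alt u v u≢ v≢ = trans (sh-inc g u v)
  (cong₂ _+_ (inc-0 (λ a l → alt (a ∷ l) v (λ ()) v≢) u) (inc-0 (λ a l → alt u (a ∷ l) u≢ (λ ())) v))

-- Words in x₀ and x₁ as sequences of exponents

κ : List ℕ → List LetterX
κ = concatMap (λ n → x₁ ∷ replicate n x₀)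

-- J (a₀ ∷ … ∷ a_d) = x₀^{a₀} x₁ x₀^{a₁} x₁ ⋯ x₁ x₀^{a_d}
J : List ℕ → List LetterX
J []      = []
J (a ∷ l) = replicate a x₀ ++ κ l

replicate-∷ʳ : ∀ {A : Set} n {x : A} → replicate n x ∷ʳ x ≡ x ∷ replicate n x
replicate-∷ʳ zero    = refl
replicate-∷ʳ (suc n) = cong (_ ∷_) (replicate-∷ʳ n)

reverse-replicate : ∀ {A : Set} n {x : A} → reverse (replicate n x) ≡ replicate n x
reverse-replicate zero    = refl
reverse-replicate (suc n) {x} = trans (unfold-reverse x (replicate n x)) (trans (cong (_∷ʳ x) (reverse-replicate n)) (replicate-∷ʳ n))

ι-∷ : ∀ a l → ιword (a ∷ l) ≡ replicate a x₀ ++ x₁ ∷ ιword l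
ι-∷ a l = ++-assoc (replicate a x₀) [ x₁ ] (ιword l)

ι-∷ʳ : ∀ l a → ιword (l ∷ʳ a) ≡ ιword l ++ (replicate a x₀ ∷ʳ x₁)
ι-∷ʳ []      a = ++-identityʳ _
ι-∷ʳ (b ∷ l) a = trans (cong ((replicate b x₀ ∷ʳ x₁) ++_) (ι-∷ʳ l a)) (sym (++-assoc (replicate b x₀ ∷ʳ x₁) (ιword l) _))

κ-∷ʳ : ∀ l a → κ (l ∷ʳ a) ≡ x₁ ∷ ιword l ++ replicate a x₀
κ-∷ʳ []      a = cong (x₁ ∷_) (++-identityʳ _)
κ-∷ʳ (b ∷ l) a = cong (x₁ ∷_) (begin
  replicate b x₀ ++ κ (l ∷ʳ a)                        ≡⟨ cong (replicate b x₀ ++_) (κ-∷ʳ l a) ⟩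
  replicate b x₀ ++ x₁ ∷ ιword l ++ replicate a x₀    ≡⟨ ++-assoc (replicate b x₀) (x₁ ∷ ιword l) _ ⟨
  (replicate b x₀ ++ x₁ ∷ ιword l) ++ replicate a x₀  ≡⟨ cong (_++ replicate a x₀) (ι-∷ b l) ⟨
  ιword (b ∷ l) ++ replicate a x₀                     ∎)

J-∷ʳ : ∀ l a → J (l ∷ʳ a) ≡ ιword l ++ replicate a x₀
J-∷ʳ []      a = ++-identityʳ _
J-∷ʳ (b ∷ l) a = ∷-injectiveʳ (κ-∷ʳ (b ∷ l) a)

J-∷ʳ0 : ∀ l → J (l ∷ʳ 0) ≡ ιword l
J-∷ʳ0 l = trans (J-∷ʳ l 0) (++-identityʳ _)

κ-∷ʳx₁ : ∀ l → κ l ∷ʳ x₁ ≡ x₁ ∷ ιword l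
κ-∷ʳx₁ []      = refl
κ-∷ʳx₁ (b ∷ l) = cong (x₁ ∷_) (begin
  (replicate b x₀ ++ κ l) ∷ʳ x₁ ≡⟨ ++-assoc (replicate b x₀) (κ l) [ x₁ ] ⟩
  replicate b x₀ ++ (κ l ∷ʳ x₁) ≡⟨ cong (replicate b x₀ ++_) (κ-∷ʳx₁ l) ⟩
  replicate b x₀ ++ x₁ ∷ ιword l ≡⟨ ι-∷ b l ⟨
  ιword (b ∷ l) ∎)

J-∷ʳx₁ : ∀ a l → J (a ∷ l) ∷ʳ x₁ ≡ ιword (a ∷ l)
J-∷ʳx₁ a l = ∷-injectiveʳ (κ-∷ʳx₁ (a ∷ l))

reverse-κ : ∀ l → reverse (κ l) ≡ ιword (reverse l)
reverse-κ []      = refl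
reverse-κ (b ∷ l) = begin
  reverse (x₁ ∷ replicate b x₀ ++ κ l)                 ≡⟨ unfold-reverse x₁ (replicate b x₀ ++ κ l) ⟩
  reverse (replicate b x₀ ++ κ l) ∷ʳ x₁                ≡⟨ cong (_∷ʳ x₁) (reverse-++ (replicate b x₀) (κ l)) ⟩
  (reverse (κ l) ++ reverse (replicate b x₀)) ∷ʳ x₁    ≡⟨ ++-assoc (reverse (κ l)) _ [ x₁ ] ⟩
  reverse (κ l) ++ (reverse (replicate b x₀) ∷ʳ x₁)    ≡⟨ cong₂ (λ p q → p ++ (q ∷ʳ x₁)) (reverse-κ l) (reverse-replicate b) ⟩
  ιword (reverse l) ++ (replicate b x₀ ∷ʳ x₁)          ≡⟨ ι-∷ʳ (reverse l) b ⟨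
  ιword (reverse l ∷ʳ b)                               ≡⟨ cong ιword (unfold-reverse b l) ⟨
  ιword (reverse (b ∷ l))                              ∎

reverse-J : ∀ a l → reverse (J (a ∷ l)) ≡ J (reverse l ∷ʳ a)
reverse-J a l = begin
  reverse (replicate a x₀ ++ κ l)              ≡⟨ reverse-++ (replicate a x₀) (κ l) ⟩
  reverse (κ l) ++ reverse (replicate a x₀)    ≡⟨ cong₂ _++_ (reverse-κ l) (reverse-replicate a) ⟩
  ιword (reverse l) ++ replicate a x₀          ≡⟨ J-∷ʳ (reverse l) a ⟨
  J (reverse l ∷ʳ a)                           ∎

length-κ : ∀ l → length (κ l) ≡ weight l
length-κ []      = refl
length-κ (a ∷ l) = cong suc (trans (length-++ (replicate a x₀)) (cong₂ ℕ._+_ (length-replicate a) (length-κ l)))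

length-ι : ∀ l → length (ιword l) ≡ weight l
length-ι []      = refl
length-ι (a ∷ l) = begin
  length (ιword (a ∷ l))                                  ≡⟨ cong length (ι-∷ a l) ⟩
  length (replicate a x₀ ++ x₁ ∷ ιword l)                 ≡⟨ length-++ (replicate a x₀) ⟩
  length (replicate a x₀) ℕ.+ suc (length (ιword l))      ≡⟨ cong₂ (λ m n → m ℕ.+ suc n) (length-replicate a) (length-ι l) ⟩
  a ℕ.+ suc (weight l)                                    ≡⟨ ℕP.+-suc a (weight l) ⟩
  weight (a ∷ l)                                          ∎

length-J : ∀ a l → length (J (a ∷ l)) ≡ a ℕ.+ weight l
length-J a l = trans (length-++ (replicate a x₀)) (cong₂ ℕ._+_ (length-replicate a) (length-κ l))

-- Inserting x₀ before any of the `a` letters of the run gives the same word. The place at the end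
-- of the run is counted in the second term, hence `nat a` and not `nat (suc a)`.
sh-x₀-block : ∀ F a w → sh F [ x₀ ] (replicate a x₀ ++ w)
  ≡ nat a * F (x₀ ∷ replicate a x₀ ++ w) + sh (F ∘ (replicate a x₀ ++_)) [ x₀ ] w
sh-x₀-block F zero    w = sym (trans (cong (_+ sh F [ x₀ ] w) (ℚ.*-zeroˡ (F (x₀ ∷ w)))) (ℚ.+-identityˡ _))
sh-x₀-block F (suc a) w = trans (cong (F (x₀ ∷ x₀ ∷ replicate a x₀ ++ w) +_) (sh-x₀-block (F ∘ (x₀ ∷_)) a w))
  (solve 3 (λ n x r → x :+ (n :* x :+ r) := (con 1ℚ :+ n) :* x :+ r) refl
    (nat a) (F (x₀ ∷ x₀ ∷ replicate a x₀ ++ w)) (sh (F ∘ (replicate (suc a) x₀ ++_)) [ x₀ ] w))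

-- A block x₀ᵃ offers `a + 1` places for a further x₀, all with the same result. This multiplicity
-- is the factor in `inc`.
sh-x₀-J : ∀ F a l → sh F [ x₀ ] (J (a ∷ l)) ≡ inc (F ∘ J) (a ∷ l)
sh-x₀-J F a l = begin
  sh F [ x₀ ] (replicate a x₀ ++ κ l)   ≡⟨ sh-x₀-block F a (κ l) ⟩
  nat a * c l + sh (F ∘ (replicate a x₀ ++_)) [ x₀ ] (κ l) ≡⟨ cong (nat a * c l +_) (rest l) ⟩
  nat a * c l + (c l + inc (F ∘ J ∘ (a ∷_)) l)
    ≡⟨ solve 3 (λ n x r → n :* x :+ (x :+ r) := (con 1ℚ :+ n) :* x :+ r) refl (nat a) (c l) (inc (F ∘ J ∘ (a ∷_)) l) ⟩
  nat (suc a) * c l + inc (F ∘ J ∘ (a ∷_)) l ∎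
  where
  c : List ℕ → ℚ
  c l = F (x₀ ∷ replicate a x₀ ++ κ l)
  x₀-shift : ∀ w → F (replicate a x₀ ++ x₀ ∷ w) ≡ F (x₀ ∷ replicate a x₀ ++ w)
  x₀-shift w = cong F (trans (sym (++-assoc (replicate a x₀) [ x₀ ] w)) (cong (_++ w) (replicate-∷ʳ a)))
  -- Supplies the missing place at the end of the run, then continues in the next block.
  rest : ∀ l → sh (F ∘ (replicate a x₀ ++_)) [ x₀ ] (κ l) ≡ c l + inc (F ∘ J ∘ (a ∷_)) l
  rest []      = trans (x₀-shift []) (sym (ℚ.+-identityʳ (c [])))
  rest (b ∷ l) = cong₂ _+_ (x₀-shift (κ (b ∷ l)))
    (trans (sh-x₀-J (F ∘ (replicate a x₀ ++_) ∘ (x₁ ∷_)) b l)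
           (inc-cong {F ∘ (replicate a x₀ ++_) ∘ (x₁ ∷_) ∘ J} {F ∘ J ∘ (a ∷_)} (λ _ _ → refl) (b ∷ l)))

-- Relations between the coefficients of a Lie element

sgn-even-or-suc-even : ∀ n → sgn n ≡ 1ℚ ⊎ suc n ℕ.% 2 ≡ 0
sgn-even-or-suc-even zero          = inj₁ refl
sgn-even-or-suc-even (suc zero)    = inj₂ refl
sgn-even-or-suc-even (suc (suc n)) with sgn-even-or-suc-even n
... | inj₁ e = inj₁ (cong (λ s → - (- s)) e)
... | inj₂ e = inj₂ e

suc-even⇒sgn : ∀ n → suc n ℕ.% 2 ≡ 0 → sgn n ≡ - 1ℚ
suc-even⇒sgn (suc zero)    e = refl
suc-even⇒sgn (suc (suc n)) e = cong (λ s → - (- s)) (suc-even⇒sgn n e)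

module _ {F : List LetterX → ℚ} (F[] : F [] ≡ 0ℚ) (altF : Alternal F) where

  private
    f : List ℕ → ℚ
    f = F ∘ J

  -- The antipode in terms of exponents. The sign is split into a part from the fixed `k` and a part
  -- from `w`, so that `sh-sgn` can take the latter out of a shuffle sum.
  J-reversal : ∀ k w → f (k ∷ w) ≡ sgn (suc k) * (sgn (weight w) * f (reverse w ∷ʳ k))
  J-reversal k w = begin
    F (J (k ∷ w))                                              ≡⟨ antipode altF F[] (J (k ∷ w)) ⟩
    sgn (suc (length (J (k ∷ w)))) * F (reverse (J (k ∷ w)))   ≡⟨ cong₂ (λ n z → sgn (suc n) * F z) (length-J k w) (reverse-J k w) ⟩
    sgn (suc k ℕ.+ weight w) * f (reverse w ∷ʳ k)              ≡⟨ cong (_* f (reverse w ∷ʳ k)) (sgn-+ (suc k) (weight w)) ⟩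
    (sgn (suc k) * sgn (weight w)) * f (reverse w ∷ʳ k)        ≡⟨ ℚ.*-assoc (sgn (suc k)) (sgn (weight w)) _ ⟩
    sgn (suc k) * (sgn (weight w) * f (reverse w ∷ʳ k))        ∎

  -- The word has weight a + b + 1: in odd weight the antipode makes `f` symmetric in depth 1, in
  -- even weight antisymmetric.
  depth1-reversal : ∀ a b → f (a ∷ b ∷ []) ≡ sgn (a ℕ.+ b) * f (b ∷ a ∷ [])
  depth1-reversal a b = trans (J-reversal a (b ∷ [])) (begin
    (- sgn a) * ((- sgn (b ℕ.+ 0)) * x)  ≡⟨ cong (λ s → (- sgn a) * ((- s) * x)) (trans (sgn-+ b 0) (ℚ.*-identityʳ (sgn b))) ⟩
    (- sgn a) * ((- sgn b) * x)        ≡⟨ solve 3 (λ s t x → (:- s) :* ((:- t) :* x) := (s :* t) :* x) refl (sgn a) (sgn b) x ⟩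
    (sgn a * sgn b) * x                ≡⟨ cong (_* x) (sgn-+ a b) ⟨
    sgn (a ℕ.+ b) * x                  ∎)
    where x = f (b ∷ a ∷ [])

  -- Two exponents guarantee an x₁, so the shuffle with x₀ is proper. In depth zero the equation
  -- would kill the unconstrained coefficient of x₀.
  translation : ∀ a b l → inc f (a ∷ b ∷ l) ≡ 0ℚ
  translation a b l = trans (sym (sh-x₀-J F a (b ∷ l))) (altF [ x₀ ] (J (a ∷ b ∷ l)) (λ ()) (J≢[] a))
    where
    J≢[] : ∀ a → J (a ∷ b ∷ l) ≢ []
    J≢[] zero    ()
    J≢[] (suc _) ()

  -- Translation invariance solved for the derivative in the last variable, which lowers the last
  -- exponent by one.
  translation-∷ʳ : ∀ l k → l ≢ [] → nat (suc k) * f (l ∷ʳ suc k) ≡ (- 1ℚ) * inc (f ∘ (_∷ʳ k)) l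
  translation-∷ʳ []      k l≢ = ⊥-elim (l≢ refl)
  translation-∷ʳ (a ∷ l) k _  = begin
    y            ≡⟨ +≡0⇒≡- (trans (ℚ.+-comm y x) (trans (sym (inc-∷ʳ f (a ∷ l) k)) (zeros l))) ⟩
    - x          ≡⟨ solve 1 (λ x → :- x := con (- 1ℚ) :* x) refl x ⟩
    (- 1ℚ) * x   ∎
    where
    x = inc (f ∘ (_∷ʳ k)) (a ∷ l)
    y = nat (suc k) * f (a ∷ l ∷ʳ suc k)
    zeros : ∀ l → inc f (a ∷ l ∷ʳ k) ≡ 0ℚ
    zeros []      = translation a k []
    zeros (b ∷ l) = translation a b (l ∷ʳ k)

  module _ (altι : Alternal (F ∘ ιword)) where

    -- Induction on the fixed last exponent. Exponent 0 gives the words ending in x₁, where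
    -- alternality is assumed; each further step applies `inc` to the other arguments, which
    -- preserves alternality.
    alternal-init : ∀ k → Alternal (f ∘ (_∷ʳ k))
    alternal-init zero    = alternal-cong (λ w → cong F (J-∷ʳ0 w)) altι
    alternal-init (suc k) u v u≢ v≢ = nat-suc-cancel k (begin
      nat (suc k) * sh (f ∘ (_∷ʳ suc k)) u v            ≡⟨ sh-* (nat (suc k)) (f ∘ (_∷ʳ suc k)) u v ⟨
      sh (λ w → nat (suc k) * f (w ∷ʳ suc k)) u v       ≡⟨ sh-cong-length u v (λ w l → translation-∷ʳ w k (nonempty u u≢ w l)) ⟩
      sh (λ w → (- 1ℚ) * inc (f ∘ (_∷ʳ k)) w) u v       ≡⟨ sh-* (- 1ℚ) (inc (f ∘ (_∷ʳ k))) u v ⟩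
      (- 1ℚ) * sh (inc (f ∘ (_∷ʳ k))) u v               ≡⟨ cong ((- 1ℚ) *_) (sh-inc-0 (alternal-init k) u v u≢ v≢) ⟩
      0ℚ                                                ∎)

      where
      nonempty : ∀ u → u ≢ [] → ∀ w → length w ≡ length u ℕ.+ length v → w ≢ []
      nonempty []      u≢ w l  _    = u≢ refl
      nonempty (_ ∷ _) u≢ w () refl

    alternal-tail : ∀ k → Alternal (f ∘ (k ∷_))
    alternal-tail k u v u≢ v≢ = begin
      sh (f ∘ (k ∷_)) u v
        ≡⟨ sh-cong (J-reversal k) u v ⟩
      sh (λ w → sgn (suc k) * (sgn (weight w) * f (reverse w ∷ʳ k))) u v
        ≡⟨ sh-* (sgn (suc k)) (λ w → sgn (weight w) * f (reverse w ∷ʳ k)) u v ⟩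
      sgn (suc k) * sh (λ w → sgn (weight w) * f (reverse w ∷ʳ k)) u v
        ≡⟨ cong (sgn (suc k) *_) (sh-sgn (λ w → f (reverse w ∷ʳ k)) u v) ⟩
      sgn (suc k) * (s * sh (f ∘ (_∷ʳ k) ∘ reverse) u v)
        ≡⟨ cong (λ z → sgn (suc k) * (s * z)) (trans (sh-reverse (f ∘ (_∷ʳ k)) u v) (alternal-init k (reverse u) (reverse v) (reverse≢[] u≢) (reverse≢[] v≢))) ⟩
      sgn (suc k) * (s * 0ℚ)
        ≡⟨ solve 2 (λ p q → p :* (q :* con 0ℚ) := con 0ℚ) refl (sgn (suc k)) s ⟩
      0ℚ ∎
      where s = sgn (weight u) * sgn (weight v)

    -- Shuffling the letter a into c₁ … c_d with c_d kept last, resp. with c₁ kept first,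
    -- the two vanishing sums differ only in their extreme terms.
    cyclic-depth≥2 : ∀ a c m d → f ((c ∷ m ∷ʳ d) ∷ʳ a) ≡ f (a ∷ c ∷ m ∷ʳ d)
    cyclic-depth≥2 a c m d = ∙-cancelʳ middle _ _ (begin
      f ((c ∷ m ∷ʳ d) ∷ʳ a) + middle            ≡⟨ sh-∷ʳ (f ∘ (c ∷_)) [] m a d ⟨
      sh (f ∘ (c ∷_)) [ a ] (m ∷ʳ d)            ≡⟨ alternal-tail c [ a ] (m ∷ʳ d) (λ ()) (∷ʳ≢[] m) ⟩
      0ℚ                                        ≡⟨ alternal-init d [ a ] (c ∷ m) (λ ()) (λ ()) ⟨
      sh (f ∘ (_∷ʳ d)) [ a ] (c ∷ m)            ∎)
      where middle = sh (λ w → f (c ∷ w ∷ʳ d)) [ a ] m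

    module _ (odd-depth1 : ∀ k → suc k ℕ.% 2 ≡ 0 → f (k ∷ 0 ∷ []) ≡ 0ℚ) where

      -- Translation moves one unit of exponent from the last block to the first, up to nonzero
      -- factors and without changing the weight, until the last block is empty.
      odd-depth1-0 : ∀ b a → suc (a ℕ.+ b) ℕ.% 2 ≡ 0 → f (a ∷ b ∷ []) ≡ 0ℚ
      odd-depth1-0 zero    a e = odd-depth1 a (subst (λ n → suc n ℕ.% 2 ≡ 0) (ℕP.+-identityʳ a) e)
      odd-depth1-0 (suc b) a e = nat-suc-cancel b (trans (translation-∷ʳ (a ∷ []) b (λ ()))
        (cong (λ z → (- 1ℚ) * (z + 0ℚ)) (trans (cong (nat (suc a) *_) z≡0) (ℚ.*-zeroʳ (nat (suc a))))))
        where
        z≡0 = odd-depth1-0 b (suc a) (subst (λ n → suc n ℕ.% 2 ≡ 0) (ℕP.+-suc a b) e)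

      -- In odd weight this is the antipode; in even weight both sides vanish by the parity
      -- condition.
      cyclic-depth1 : ∀ a b → f (b ∷ a ∷ []) ≡ f (a ∷ b ∷ [])
      cyclic-depth1 a b with sgn-even-or-suc-even (a ℕ.+ b)
      ... | inj₁ e = sym (trans (depth1-reversal a b) (trans (cong (_* f (b ∷ a ∷ [])) e) (ℚ.*-identityˡ _)))
      ... | inj₂ e = trans (odd-depth1-0 a b (subst (λ n → suc n ℕ.% 2 ≡ 0) (ℕP.+-comm a b) e)) (sym (odd-depth1-0 b a e))

      cyclic : ∀ a w → w ≢ [] → f (w ∷ʳ a) ≡ f (a ∷ w)
      cyclic a []      w≢ = ⊥-elim (w≢ refl)
      cyclic a (c ∷ w) w≢ with initLast w
      ... | []      = cyclic-depth1 a c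
      ... | m ∷ʳ′ d = cyclic-depth≥2 a c m d

  -- In even weight the antipode makes the two values opposite, so their equality forces both to be
  -- zero.
  symmetric⇒odd-depth1 : (∀ k → f (0 ∷ k ∷ []) ≡ f (k ∷ 0 ∷ [])) → ∀ k → suc k ℕ.% 2 ≡ 0 → f (k ∷ 0 ∷ []) ≡ 0ℚ
  symmetric⇒odd-depth1 symm k e = self-negative⇒≡0 (begin
    x            ≡⟨ symm k ⟨
    f (0 ∷ k ∷ []) ≡⟨ depth1-reversal 0 k ⟩
    sgn k * x    ≡⟨ cong (_* x) (suc-even⇒sgn k e) ⟩
    (- 1ℚ) * x   ≡⟨ solve 1 (λ x → con (- 1ℚ) :* x := :- x) refl x ⟩
    - x          ∎)
    where x = f (k ∷ 0 ∷ [])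

-- Pairing of formal combinations with functions on the basis

⟨_,_⟩ : Lin B → (B → ℚ) → ℚ
⟨ []          , H ⟩ = 0ℚ
⟨ (c , b) ∷ p , H ⟩ = c * H b + ⟨ p , H ⟩

pair-cong : ∀ (p : Lin B) {H K} → (∀ b → H b ≡ K b) → ⟨ p , H ⟩ ≡ ⟨ p , K ⟩
pair-cong []            e = refl
pair-cong ((c , b) ∷ p) e = cong₂ _+_ (cong (c *_) (e b)) (pair-cong p e)

pair-0 : ∀ (p : Lin B) {H} → (∀ b → H b ≡ 0ℚ) → ⟨ p , H ⟩ ≡ 0ℚ
pair-0 []            e = refl
pair-0 ((c , b) ∷ p) e = cong₂ _+_ (trans (cong (c *_) (e b)) (ℚ.*-zeroʳ c)) (pair-0 p e)

pair-+ : ∀ (p : Lin B) H K → ⟨ p , (λ b → H b + K b) ⟩ ≡ ⟨ p , H ⟩ + ⟨ p , K ⟩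
pair-+ []            H K = refl
pair-+ ((c , b) ∷ p) H K = trans (cong (c * (H b + K b) +_) (pair-+ p H K))
  (solve 5 (λ c h k r s → c :* (h :+ k) :+ (r :+ s) := (c :* h :+ r) :+ (c :* k :+ s)) refl c (H b) (K b) ⟨ p , H ⟩ ⟨ p , K ⟩)

pair-* : ∀ (p : Lin B) a H → ⟨ p , (λ b → a * H b) ⟩ ≡ a * ⟨ p , H ⟩
pair-* []            a H = sym (ℚ.*-zeroʳ a)
pair-* ((c , b) ∷ p) a H = trans (cong (c * (a * H b) +_) (pair-* p a H))
  (solve 4 (λ a c h r → c :* (a :* h) :+ a :* r := a :* (c :* h :+ r)) refl a c (H b) ⟨ p , H ⟩)

pair-swap : ∀ (p : Lin B) (q : Lin C) (H : B → C → ℚ) →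
  ⟨ p , (λ b → ⟨ q , H b ⟩) ⟩ ≡ ⟨ q , (λ c → ⟨ p , (λ b → H b c) ⟩) ⟩
pair-swap []            q H = sym (pair-0 q (λ _ → refl))
pair-swap ((c , b) ∷ p) q H = begin
  c * ⟨ q , H b ⟩ + ⟨ p , (λ b → ⟨ q , H b ⟩) ⟩
    ≡⟨ cong₂ _+_ (sym (pair-* q c (H b))) (pair-swap p q H) ⟩
  ⟨ q , (λ d → c * H b d) ⟩ + ⟨ q , (λ d → ⟨ p , (λ b → H b d) ⟩) ⟩
    ≡⟨ pair-+ q (λ d → c * H b d) (λ d → ⟨ p , (λ b → H b d) ⟩) ⟨
  ⟨ q , (λ d → c * H b d + ⟨ p , (λ b → H b d) ⟩) ⟩ ∎

pair-++ : ∀ (p q : Lin B) H → ⟨ p ++ q , H ⟩ ≡ ⟨ p , H ⟩ + ⟨ q , H ⟩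
pair-++ []            q H = sym (ℚ.+-identityˡ _)
pair-++ ((c , b) ∷ p) q H = trans (cong (c * H b +_) (pair-++ p q H)) (sym (ℚ.+-assoc (c * H b) ⟨ p , H ⟩ ⟨ q , H ⟩))

pair-scale : ∀ a (p : Lin B) H → ⟨ scale a p , H ⟩ ≡ a * ⟨ p , H ⟩
pair-scale a []            H = sym (ℚ.*-zeroʳ a)
pair-scale a ((c , b) ∷ p) H = trans (cong₂ _+_ (ℚ.*-assoc a c (H b)) (pair-scale a p H)) (sym (ℚ.*-distribˡ-+ a (c * H b) ⟨ p , H ⟩))

pair-extend : ∀ (f : B → Lin C) p H → ⟨ extend f p , H ⟩ ≡ ⟨ p , (λ b → ⟨ f b , H ⟩) ⟩
pair-extend f []            H = refl
pair-extend f ((c , b) ∷ p) H = trans (pair-++ (scale c (f b)) (extend f p) H)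
  (cong₂ _+_ (pair-scale c (f b) H) (pair-extend f p H))

pair-single : ∀ (b : B) H → ⟨ (1ℚ , b) ∷ [] , H ⟩ ≡ H b
pair-single b H = solve 1 (λ h → con 1ℚ :* h :+ con 0ℚ := h) refl (H b)

δ : DecidableEquality B → B → B → ℚ
δ eq b b′ with eq b′ b
... | yes _ = 1ℚ
... | no  _ = 0ℚ

δ-≡ : ∀ (eq : DecidableEquality B) b → δ eq b b ≡ 1ℚ
δ-≡ eq b with eq b b
... | yes _ = refl
... | no ne = ⊥-elim (ne refl)

δ-≢ : ∀ (eq : DecidableEquality B) b b′ → b′ ≢ b → δ eq b b′ ≡ 0ℚ
δ-≢ eq b b′ ne with eq b′ b
... | yes e = ⊥-elim (ne e)
... | no _  = refl

δ-injective : ∀ (eqB : DecidableEquality B) (eqC : DecidableEquality C) (f : B → C) →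
  (∀ {b b′} → f b′ ≡ f b → b′ ≡ b) → ∀ b b′ → δ eqC (f b) (f b′) ≡ δ eqB b b′
δ-injective eqB eqC f inj b b′ with eqB b′ b
... | yes refl = δ-≡ eqC (f b)
... | no ne    = δ-≢ eqC (f b) (f b′) (ne ∘ inj)

module _ (eq : DecidableEquality B) where

  coeff-pair : ∀ p b → coeff eq p b ≡ ⟨ p , δ eq b ⟩
  coeff-pair []             b = refl
  coeff-pair ((c , b′) ∷ p) b with eq b′ b
  ... | yes _ = cong₂ _+_ (sym (ℚ.*-identityʳ c)) (coeff-pair p b)
  ... | no  _ = trans (coeff-pair p b) (sym (trans (cong (_+ ⟨ p , δ eq b ⟩) (ℚ.*-zeroʳ c)) (ℚ.+-identityˡ _)))

  coeff-++ : ∀ p q b → coeff eq (p ++ q) b ≡ coeff eq p b + coeff eq q b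
  coeff-++ p q b = trans (coeff-pair (p ++ q) b)
    (trans (pair-++ p q (δ eq b)) (sym (cong₂ _+_ (coeff-pair p b) (coeff-pair q b))))

  coeff-scale : ∀ a p b → coeff eq (scale a p) b ≡ a * coeff eq p b
  coeff-scale a p b = trans (coeff-pair (scale a p) b) (trans (pair-scale a p (δ eq b)) (cong (a *_) (sym (coeff-pair p b))))

  private
    remove : B → Lin B → Lin B
    remove b []             = []
    remove b ((c , b′) ∷ p) with eq b′ b
    ... | yes _ = remove b p
    ... | no  _ = (c , b′) ∷ remove b p

    length-remove : ∀ b p → length (remove b p) ℕ.≤ length p
    length-remove b []             = ℕ.z≤n
    length-remove b ((c , b′) ∷ p) with eq b′ b
    ... | yes _ = ℕP.m≤n⇒m≤1+n (length-remove b p)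
    ... | no  _ = ℕ.s≤s (length-remove b p)

    pair-remove : ∀ b p H → ⟨ p , H ⟩ ≡ coeff eq p b * H b + ⟨ remove b p , H ⟩
    pair-remove b []             H = sym (trans (cong (_+ 0ℚ) (ℚ.*-zeroˡ (H b))) refl)
    pair-remove b ((c , b′) ∷ p) H with eq b′ b
    ... | yes refl = trans (cong (c * H b +_) (pair-remove b p H))
      (solve 4 (λ c h k r → c :* h :+ (k :* h :+ r) := (c :+ k) :* h :+ r) refl c (H b) (coeff eq p b) ⟨ remove b p , H ⟩)
    ... | no  _ = trans (cong (c * H b′ +_) (pair-remove b p H))
      (solve 3 (λ x y r → x :+ (y :+ r) := y :+ (x :+ r)) refl (c * H b′) (coeff eq p b * H b) ⟨ remove b p , H ⟩)

    coeff-remove-0 : ∀ b p → (∀ a → coeff eq p a ≡ 0ℚ) → ∀ a → coeff eq (remove b p) a ≡ 0ℚ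
    coeff-remove-0 b p e a = begin
      coeff eq (remove b p) a                             ≡⟨ coeff-pair (remove b p) a ⟩
      r                                                   ≡⟨ solve 2 (λ r d → r := con 0ℚ :* d :+ r) refl r (δ eq a b) ⟩
      0ℚ * δ eq a b + r                                   ≡⟨ cong (λ z → z * δ eq a b + r) (e b) ⟨
      coeff eq p b * δ eq a b + r                         ≡⟨ pair-remove b p (δ eq a) ⟨
      ⟨ p , δ eq a ⟩                                      ≡⟨ coeff-pair p a ⟨
      coeff eq p a                                        ≡⟨ e a ⟩
      0ℚ                                                  ∎
      where r = ⟨ remove b p , δ eq a ⟩

    -- The bound `n` carries the recursion: removing every occurrence of the first basis element
    -- shortens the list but does not give a structural sublist.
    coeff-0⇒pair-0 : ∀ n p → length p ℕ.≤ n → (∀ b → coeff eq p b ≡ 0ℚ) → ∀ H → ⟨ p , H ⟩ ≡ 0ℚ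
    coeff-0⇒pair-0 n       []            _ e H = refl
    coeff-0⇒pair-0 (suc n) ((c , b) ∷ p) (ℕ.s≤s l) e H = begin
      ⟨ (c , b) ∷ p , H ⟩                                     ≡⟨ pair-remove b ((c , b) ∷ p) H ⟩
      coeff eq ((c , b) ∷ p) b * H b + ⟨ remove b ((c , b) ∷ p) , H ⟩
        ≡⟨ cong₂ _+_ (trans (cong (_* H b) (e b)) (ℚ.*-zeroˡ (H b)))
             (coeff-0⇒pair-0 n (remove b ((c , b) ∷ p)) (ℕP.≤-trans shorter l) (coeff-remove-0 b ((c , b) ∷ p) e) H) ⟩
      0ℚ ∎
      where
      shorter : length (remove b ((c , b) ∷ p)) ℕ.≤ length p
      shorter with eq b b
      ... | yes _ = length-remove b p
      ... | no ne = ⊥-elim (ne refl)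

  -- A formal combination with all coefficients zero need not be the empty list,
  -- so this is proved by collecting the terms of one basis element at a time.
  coeff⇒pair : ∀ p q → (∀ b → coeff eq p b ≡ coeff eq q b) → ∀ H → ⟨ p , H ⟩ ≡ ⟨ q , H ⟩
  coeff⇒pair p q e H = begin
    ⟨ p , H ⟩                                    ≡⟨ solve 2 (λ x y → x := (x :+ con (- 1ℚ) :* y) :+ y) refl ⟨ p , H ⟩ ⟨ q , H ⟩ ⟩
    (⟨ p , H ⟩ + (- 1ℚ) * ⟨ q , H ⟩) + ⟨ q , H ⟩ ≡⟨ cong (_+ ⟨ q , H ⟩) (trans (pair-++ p (scale (- 1ℚ) q) H) (cong (⟨ p , H ⟩ +_) (pair-scale (- 1ℚ) q H))) ⟨
    ⟨ p ++ scale (- 1ℚ) q , H ⟩ + ⟨ q , H ⟩      ≡⟨ cong (_+ ⟨ q , H ⟩) (coeff-0⇒pair-0 _ (p ++ scale (- 1ℚ) q) ℕP.≤-refl zeros H) ⟩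
    0ℚ + ⟨ q , H ⟩                               ≡⟨ ℚ.+-identityˡ _ ⟩
    ⟨ q , H ⟩                                    ∎
    where
    zeros : ∀ b → coeff eq (p ++ scale (- 1ℚ) q) b ≡ 0ℚ
    zeros b = begin
      coeff eq (p ++ scale (- 1ℚ) q) b               ≡⟨ coeff-++ p (scale (- 1ℚ) q) b ⟩
      coeff eq p b + coeff eq (scale (- 1ℚ) q) b     ≡⟨ cong₂ _+_ (e b) (coeff-scale (- 1ℚ) q b) ⟩
      coeff eq q b + (- 1ℚ) * coeff eq q b           ≡⟨ solve 1 (λ x → x :+ con (- 1ℚ) :* x := con 0ℚ) refl (coeff eq q b) ⟩
      0ℚ                                             ∎

  pair⇒coeff : ∀ p q → (∀ H → ⟨ p , H ⟩ ≡ ⟨ q , H ⟩) → ∀ b → coeff eq p b ≡ coeff eq q b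
  pair⇒coeff p q e b = trans (coeff-pair p b) (trans (e (δ eq b)) (sym (coeff-pair q b)))

-- Coproduct, shuffle duality and primitive elements

module FreeAlgProps {A : Set} (_≟A_ : DecidableEquality A) where
  open FreeAlg _≟A_

  pair-mul : ∀ p q H → ⟨ mul p q , H ⟩ ≡ ⟨ p , (λ u → ⟨ q , (λ v → H (u ++ v)) ⟩) ⟩
  pair-mul []            q H = refl
  pair-mul ((c , u) ∷ p) q H = trans (pair-++ (map _ q) (mul p q) H) (cong₂ _+_ (inner q) (pair-mul p q H))
    where
    inner : ∀ q → ⟨ map (λ { (d , v) → (c * d , u ++ v) }) q , H ⟩ ≡ c * ⟨ q , (λ v → H (u ++ v)) ⟩
    inner []            = sym (ℚ.*-zeroʳ c)
    inner ((d , v) ∷ q) = trans (cong₂ _+_ (ℚ.*-assoc c d (H (u ++ v))) (inner q)) (sym (ℚ.*-distribˡ-+ c (d * H (u ++ v)) _))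

  pair-mul-word : ∀ p w H → ⟨ mul p (word w) , H ⟩ ≡ ⟨ p , (λ u → H (u ++ w)) ⟩
  pair-mul-word p w H = trans (pair-mul p (word w) H) (pair-cong p (λ u → pair-single w (λ v → H (u ++ v))))

  pair-word-mul : ∀ w p H → ⟨ mul (word w) p , H ⟩ ≡ ⟨ p , (λ u → H (w ++ u)) ⟩
  pair-word-mul w p H = trans (pair-mul (word w) p H) (pair-single w (λ u → ⟨ p , (λ v → H (u ++ v)) ⟩))

  pair-⊖ : ∀ p q H → ⟨ p ⊖ q , H ⟩ ≡ ⟨ p , H ⟩ + (- 1ℚ) * ⟨ q , H ⟩
  pair-⊖ p q H = trans (pair-++ p (scale (- 1ℚ) q) H) (cong (⟨ p , H ⟩ +_) (pair-scale (- 1ℚ) q H))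

  -- Transpose of left multiplication by a ⊗ 1 + 1 ⊗ a.
  split : A → (List A × List A → ℚ) → List A × List A → ℚ
  split a H (u , v) = H (a ∷ u , v) + H (u , a ∷ v)

  pair-Δ-∷ : ∀ a w H → ⟨ Δword (a ∷ w) , H ⟩ ≡ ⟨ Δword w , split a H ⟩
  pair-Δ-∷ a w H = go (Δword w)
    where
    go : ∀ t → ⟨ concatMap (λ { (c , u , v) → (c , a ∷ u , v) ∷ (c , u , a ∷ v) ∷ [] }) t , H ⟩ ≡ ⟨ t , split a H ⟩
    go []                = refl
    go ((c , u , v) ∷ t) = trans (cong (λ z → c * H (a ∷ u , v) + (c * H (u , a ∷ v) + z)) (go t))
      (solve 4 (λ c h k r → c :* h :+ (c :* k :+ r) := c :* (h :+ k) :+ r) refl c (H (a ∷ u , v)) (H (u , a ∷ v)) ⟨ t , split a H ⟩)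

  -- Multiplicativity of Δ, in transposed form.
  pair-Δ-++ : ∀ w v H → ⟨ Δword (w ++ v) , H ⟩
    ≡ ⟨ Δword w , (λ (w₁ , w₂) → ⟨ Δword v , (λ (v₁ , v₂) → H (w₁ ++ v₁ , w₂ ++ v₂)) ⟩) ⟩
  pair-Δ-++ []      v H = sym (pair-single ([] , []) (λ (w₁ , w₂) → ⟨ Δword v , (λ (v₁ , v₂) → H (w₁ ++ v₁ , w₂ ++ v₂)) ⟩))
  pair-Δ-++ (a ∷ w) v H = begin
    ⟨ Δword (a ∷ w ++ v) , H ⟩       ≡⟨ pair-Δ-∷ a (w ++ v) H ⟩
    ⟨ Δword (w ++ v) , split a H ⟩   ≡⟨ pair-Δ-++ w v (split a H) ⟩
    _                                ≡⟨ pair-cong (Δword w) (λ { (w₁ , w₂) → pair-+ (Δword v) _ _ }) ⟩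
    _                                ≡⟨ pair-Δ-∷ a w _ ⟨
    _                                ∎

  pair-Δ : ∀ p H → ⟨ Δ p , H ⟩ ≡ ⟨ p , (λ w → ⟨ Δword w , H ⟩) ⟩
  pair-Δ = pair-extend Δword

  pair-prim : ∀ p H → ⟨ prim p , H ⟩ ≡ ⟨ p , (λ w → H (w , []) + H ([] , w)) ⟩
  pair-prim p H = begin
    ⟨ prim p , H ⟩  ≡⟨ pair-++ (map _ p) (map _ p) H ⟩
    _ ≡⟨ cong₂ _+_ (left p) (right p) ⟩
    ⟨ p , (λ w → H (w , [])) ⟩ + ⟨ p , (λ w → H ([] , w)) ⟩ ≡⟨ pair-+ p _ _ ⟨
    ⟨ p , (λ w → H (w , []) + H ([] , w)) ⟩ ∎
    where
    left : ∀ p → ⟨ map (λ { (c , w) → (c , w , []) }) p , H ⟩ ≡ ⟨ p , (λ w → H (w , [])) ⟩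
    left []            = refl
    left ((c , w) ∷ p) = cong (c * H (w , []) +_) (left p)
    right : ∀ p → ⟨ map (λ { (c , w) → (c , [] , w) }) p , H ⟩ ≡ ⟨ p , (λ w → H ([] , w)) ⟩
    right []            = refl
    right ((c , w) ∷ p) = cong (c * H ([] , w) +_) (right p)

  pair-⊗id : ∀ S t H → ⟨ (S ⊗id) t , H ⟩ ≡ ⟨ t , (λ (u , v) → ⟨ S u , (λ u′ → H (u′ , v)) ⟩) ⟩
  pair-⊗id S t H = trans (pair-extend _ t H) (pair-cong t (λ { (u , v) → go v (S u) }))
    where
    go : ∀ v p → ⟨ map (λ { (c , u′) → (c , u′ , v) }) p , H ⟩ ≡ ⟨ p , (λ u′ → H (u′ , v)) ⟩
    go v []            = refl
    go v ((c , w) ∷ p) = cong (c * H (w , v) +_) (go v p)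

  pair-id⊗ : ∀ S t H → ⟨ (id⊗ S) t , H ⟩ ≡ ⟨ t , (λ (u , v) → ⟨ S v , (λ v′ → H (u , v′)) ⟩) ⟩
  pair-id⊗ S t H = trans (pair-extend _ t H) (pair-cong t (λ { (u , v) → go u (S v) }))
    where
    go : ∀ u p → ⟨ map (λ { (c , v′) → (c , u , v′) }) p , H ⟩ ≡ ⟨ p , (λ v′ → H (u , v′)) ⟩
    go u []            = refl
    go u ((c , w) ∷ p) = cong (c * H (u , w) +_) (go u p)

  sh-pair : ∀ (p : Lin B) (G : List A → B → ℚ) u v →
    sh (λ w → ⟨ p , G w ⟩) u v ≡ ⟨ p , (λ b → sh (λ w → G w b) u v) ⟩
  sh-pair p G []      v       = refl
  sh-pair p G (a ∷ u) []      = refl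
  sh-pair p G (a ∷ u) (b ∷ v) = trans
    (cong₂ _+_ (sh-pair p (G ∘ (a ∷_)) u (b ∷ v)) (sh-pair p (G ∘ (b ∷_)) (a ∷ u) v))
    (sym (pair-+ p _ _))

  private
    δw = δ wordEq
    δp = δ pairEq

    δ-∷ : ∀ a c w w′ → δw (c ∷ w) (a ∷ w′) ≡ δ _≟A_ c a * δw w w′
    δ-∷ a c w w′ = by (a ≟A c)
      where
      by : Dec (a ≡ c) → δw (c ∷ w) (a ∷ w′) ≡ δ _≟A_ c a * δw w w′
      by (yes refl) = trans (δ-injective wordEq wordEq (a ∷_) (λ { refl → refl }) w w′)
        (sym (trans (cong (_* δw w w′) (δ-≡ _≟A_ a)) (ℚ.*-identityˡ (δw w w′))))
      by (no ne)    = trans (δ-≢ wordEq (c ∷ w) (a ∷ w′) (λ { refl → ne refl }))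
        (sym (trans (cong (_* δw w w′) (δ-≢ _≟A_ c a ne)) (ℚ.*-zeroˡ (δw w w′))))

    δ-pair : ∀ u v u′ v′ → δp (u , v) (u′ , v′) ≡ δw u u′ * δw v v′
    δ-pair u v u′ v′ = by (wordEq u′ u)
      where
      by : Dec (u′ ≡ u) → δp (u , v) (u′ , v′) ≡ δw u u′ * δw v v′
      by (yes refl) = trans (δ-injective wordEq pairEq (u ,_) (λ { refl → refl }) v v′)
        (sym (trans (cong (_* δw v v′) (δ-≡ wordEq u)) (ℚ.*-identityˡ (δw v v′))))
      by (no ne)    = trans (δ-≢ pairEq (u , v) (u′ , v′) (λ { refl → ne refl }))
        (sym (trans (cong (_* δw v v′) (δ-≢ wordEq u u′ ne)) (ℚ.*-zeroˡ (δw v v′))))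

    δ-∷ˡ : ∀ a c u v t → δp (c ∷ u , v) (a ∷ proj₁ t , proj₂ t) ≡ δ _≟A_ c a * δp (u , v) t
    δ-∷ˡ a c u v (u′ , v′) = begin
      δp (c ∷ u , v) (a ∷ u′ , v′)            ≡⟨ δ-pair (c ∷ u) v (a ∷ u′) v′ ⟩
      δw (c ∷ u) (a ∷ u′) * δw v v′           ≡⟨ cong (_* δw v v′) (δ-∷ a c u u′) ⟩
      (δ _≟A_ c a * δw u u′) * δw v v′        ≡⟨ ℚ.*-assoc (δ _≟A_ c a) (δw u u′) (δw v v′) ⟩
      δ _≟A_ c a * (δw u u′ * δw v v′)        ≡⟨ cong (δ _≟A_ c a *_) (δ-pair u v u′ v′) ⟨
      δ _≟A_ c a * δp (u , v) (u′ , v′)       ∎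

    δ-∷ʳ : ∀ a c u v t → δp (u , c ∷ v) (proj₁ t , a ∷ proj₂ t) ≡ δ _≟A_ c a * δp (u , v) t
    δ-∷ʳ a c u v (u′ , v′) = begin
      δp (u , c ∷ v) (u′ , a ∷ v′)            ≡⟨ δ-pair u (c ∷ v) u′ (a ∷ v′) ⟩
      δw u u′ * δw (c ∷ v) (a ∷ v′)           ≡⟨ cong (δw u u′ *_) (δ-∷ a c v v′) ⟩
      δw u u′ * (δ _≟A_ c a * δw v v′)        ≡⟨ solve 3 (λ p q r → p :* (q :* r) := q :* (p :* r)) refl (δw u u′) (δ _≟A_ c a) (δw v v′) ⟩
      δ _≟A_ c a * (δw u u′ * δw v v′)        ≡⟨ cong (δ _≟A_ c a *_) (δ-pair u v u′ v′) ⟨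
      δ _≟A_ c a * δp (u , v) (u′ , v′)       ∎

  -- Both sides are the multiplicity of w among the shuffles of u and v.
  pair-Δ-δ : ∀ w u v → ⟨ Δword w , δ pairEq (u , v) ⟩ ≡ sh (λ w′ → δ wordEq w′ w) u v
  pair-Δ-δ []      u v = trans (pair-single ([] , []) (δp (u , v))) (nil u v)
    where
    nil : ∀ u v → δp (u , v) ([] , []) ≡ sh (λ w′ → δw w′ []) u v
    nil []      v       = δ-injective wordEq pairEq ([] ,_) (λ { refl → refl }) v []
    nil (a ∷ u) []      = δ-injective wordEq pairEq (_, []) (λ { refl → refl }) (a ∷ u) []
    nil (a ∷ u) (b ∷ v) = trans (δ-≢ pairEq (a ∷ u , b ∷ v) ([] , []) (λ ()))
      (sym (cong₂ _+_ (sh-0 _ (λ w → δ-≢ wordEq (a ∷ w) [] (λ ())) u (b ∷ v)) (sh-0 _ (λ w → δ-≢ wordEq (b ∷ w) [] (λ ())) (a ∷ u) v)))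
  pair-Δ-δ (a ∷ w) u v = begin
    ⟨ Δword (a ∷ w) , δp (u , v) ⟩         ≡⟨ pair-Δ-∷ a w (δp (u , v)) ⟩
    ⟨ Δword w , split a (δp (u , v)) ⟩     ≡⟨ pair-+ (Δword w) (left u v) (right u v) ⟩
    ⟨ Δword w , left u v ⟩ + ⟨ Δword w , right u v ⟩ ≡⟨ cases u v ⟩
    sh (λ w′ → δw w′ (a ∷ w)) u v ∎
    where
    left right : List A → List A → List A × List A → ℚ
    left  u v (u′ , v′) = δp (u , v) (a ∷ u′ , v′)
    right u v (u′ , v′) = δp (u , v) (u′ , a ∷ v′)

    left-[] : ∀ v → ⟨ Δword w , left [] v ⟩ ≡ 0ℚ
    left-[] v = pair-0 (Δword w) (λ (u′ , v′) → δ-≢ pairEq ([] , v) (a ∷ u′ , v′) (λ ()))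

    right-[] : ∀ u → ⟨ Δword w , right u [] ⟩ ≡ 0ℚ
    right-[] u = pair-0 (Δword w) (λ (u′ , v′) → δ-≢ pairEq (u , []) (u′ , a ∷ v′) (λ ()))

    sh-δ-∷ : ∀ c u v → sh (λ w′ → δw (c ∷ w′) (a ∷ w)) u v ≡ δ _≟A_ c a * sh (λ w′ → δw w′ w) u v
    sh-δ-∷ c u v = trans (sh-cong (λ w′ → δ-∷ a c w′ w) u v) (sh-* (δ _≟A_ c a) (λ w′ → δw w′ w) u v)

    left-∷ : ∀ c u v → ⟨ Δword w , left (c ∷ u) v ⟩ ≡ sh (λ w′ → δw (c ∷ w′) (a ∷ w)) u v
    left-∷ c u v = begin
      ⟨ Δword w , left (c ∷ u) v ⟩                      ≡⟨ pair-cong (Δword w) (δ-∷ˡ a c u v) ⟩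
      ⟨ Δword w , (λ t → δ _≟A_ c a * δp (u , v) t) ⟩   ≡⟨ pair-* (Δword w) (δ _≟A_ c a) (δp (u , v)) ⟩
      δ _≟A_ c a * ⟨ Δword w , δp (u , v) ⟩             ≡⟨ cong (δ _≟A_ c a *_) (pair-Δ-δ w u v) ⟩
      δ _≟A_ c a * sh (λ w′ → δw w′ w) u v              ≡⟨ sh-δ-∷ c u v ⟨
      sh (λ w′ → δw (c ∷ w′) (a ∷ w)) u v               ∎

    right-∷ : ∀ c u v → ⟨ Δword w , right u (c ∷ v) ⟩ ≡ sh (λ w′ → δw (c ∷ w′) (a ∷ w)) u v
    right-∷ c u v = begin
      ⟨ Δword w , right u (c ∷ v) ⟩                     ≡⟨ pair-cong (Δword w) (δ-∷ʳ a c u v) ⟩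
      ⟨ Δword w , (λ t → δ _≟A_ c a * δp (u , v) t) ⟩   ≡⟨ pair-* (Δword w) (δ _≟A_ c a) (δp (u , v)) ⟩
      δ _≟A_ c a * ⟨ Δword w , δp (u , v) ⟩             ≡⟨ cong (δ _≟A_ c a *_) (pair-Δ-δ w u v) ⟩
      δ _≟A_ c a * sh (λ w′ → δw w′ w) u v              ≡⟨ sh-δ-∷ c u v ⟨
      sh (λ w′ → δw (c ∷ w′) (a ∷ w)) u v               ∎

    cases : ∀ u v → ⟨ Δword w , left u v ⟩ + ⟨ Δword w , right u v ⟩ ≡ sh (λ w′ → δw w′ (a ∷ w)) u v
    cases []      []      = trans (cong₂ _+_ (left-[] []) (right-[] [])) (sym (δ-≢ wordEq [] (a ∷ w) (λ ())))
    cases []      (d ∷ v) = trans (cong₂ _+_ (left-[] (d ∷ v)) (right-∷ d [] v)) (ℚ.+-identityˡ _)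
    cases (c ∷ u) []      = trans (cong₂ _+_ (trans (left-∷ c u []) (sh-[]ʳ _ u)) (right-[] (c ∷ u))) (ℚ.+-identityʳ _)
    cases (c ∷ u) (d ∷ v) = cong₂ _+_ (left-∷ c u (d ∷ v)) (right-∷ d (c ∷ u) v)

  -- The coproduct with primitive letters is dual to the shuffle product.
  coef₂-Δ : ∀ p u v → coef₂ (Δ p) (u , v) ≡ sh (coef p) u v
  coef₂-Δ p u v = begin
    coef₂ (Δ p) (u , v)                              ≡⟨ coeff-pair pairEq (Δ p) (u , v) ⟩
    ⟨ Δ p , δp (u , v) ⟩                             ≡⟨ pair-Δ p (δp (u , v)) ⟩
    ⟨ p , (λ w → ⟨ Δword w , δp (u , v) ⟩) ⟩         ≡⟨ pair-cong p (λ w → pair-Δ-δ w u v) ⟩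
    ⟨ p , (λ w → sh (λ w′ → δw w′ w) u v) ⟩          ≡⟨ sh-pair p δw u v ⟨
    sh (λ w → ⟨ p , δw w ⟩) u v                      ≡⟨ sh-cong (coeff-pair wordEq p) u v ⟨
    sh (coef p) u v                                  ∎

  coef₂-prim : ∀ p uv → coef₂ (prim p) uv ≡ ⟨ p , (λ w → δ pairEq uv (w , []) + δ pairEq uv ([] , w)) ⟩
  coef₂-prim p uv = trans (coeff-pair pairEq (prim p) uv) (pair-prim p (δp uv))

  private
    prim-∷∷ : ∀ p a u b v → coef₂ (prim p) (a ∷ u , b ∷ v) ≡ 0ℚ
    prim-∷∷ p a u b v = trans (coef₂-prim p (a ∷ u , b ∷ v)) (pair-0 p (λ w →
      cong₂ _+_ (δ-≢ pairEq (a ∷ u , b ∷ v) (w , []) (λ ())) (δ-≢ pairEq (a ∷ u , b ∷ v) ([] , w) (λ ()))))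

    prim-[]ˡ : ∀ p b v → coef₂ (prim p) ([] , b ∷ v) ≡ coef p (b ∷ v)
    prim-[]ˡ p b v = begin
      coef₂ (prim p) ([] , b ∷ v) ≡⟨ coef₂-prim p ([] , b ∷ v) ⟩
      _ ≡⟨ pair-cong p (λ w → trans
             (cong₂ _+_ (δ-≢ pairEq ([] , b ∷ v) (w , []) (λ ())) (δ-injective wordEq pairEq ([] ,_) (λ { refl → refl }) (b ∷ v) w))
             (ℚ.+-identityˡ _)) ⟩
      ⟨ p , δw (b ∷ v) ⟩ ≡⟨ coeff-pair wordEq p (b ∷ v) ⟨
      coef p (b ∷ v) ∎

    prim-[]ʳ : ∀ p a u → coef₂ (prim p) (a ∷ u , []) ≡ coef p (a ∷ u)
    prim-[]ʳ p a u = begin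
      coef₂ (prim p) (a ∷ u , []) ≡⟨ coef₂-prim p (a ∷ u , []) ⟩
      _ ≡⟨ pair-cong p (λ w → trans
             (cong₂ _+_ (δ-injective wordEq pairEq (_, []) (λ { refl → refl }) (a ∷ u) w) (δ-≢ pairEq (a ∷ u , []) ([] , w) (λ ())))
             (ℚ.+-identityʳ _)) ⟩
      ⟨ p , δw (a ∷ u) ⟩ ≡⟨ coeff-pair wordEq p (a ∷ u) ⟨
      coef p (a ∷ u) ∎

    prim-[] : ∀ p → coef₂ (prim p) ([] , []) ≡ coef p [] + coef p []
    prim-[] p = begin
      coef₂ (prim p) ([] , []) ≡⟨ coef₂-prim p ([] , []) ⟩
      _ ≡⟨ pair-cong p (λ w → cong₂ _+_
             (δ-injective wordEq pairEq (_, []) (λ { refl → refl }) [] w)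
             (δ-injective wordEq pairEq ([] ,_) (λ { refl → refl }) [] w)) ⟩
      ⟨ p , (λ w → δw [] w + δw [] w) ⟩ ≡⟨ pair-+ p (δw []) (δw []) ⟩
      ⟨ p , δw [] ⟩ + ⟨ p , δw [] ⟩ ≡⟨ cong₂ _+_ (coeff-pair wordEq p []) (coeff-pair wordEq p []) ⟨
      coef p [] + coef p [] ∎

  primitive⇒alternal : ∀ p → IsPrimitive p → Alternal (coef p)
  primitive⇒alternal p isPrim []      v       u≢ v≢ = ⊥-elim (u≢ refl)
  primitive⇒alternal p isPrim (_ ∷ _) []      u≢ v≢ = ⊥-elim (v≢ refl)
  primitive⇒alternal p isPrim (a ∷ u) (b ∷ v) u≢ v≢ = begin
    sh (coef p) (a ∷ u) (b ∷ v)        ≡⟨ coef₂-Δ p (a ∷ u) (b ∷ v) ⟨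
    coef₂ (Δ p) (a ∷ u , b ∷ v)        ≡⟨ isPrim (a ∷ u , b ∷ v) ⟩
    coef₂ (prim p) (a ∷ u , b ∷ v)     ≡⟨ prim-∷∷ p a u b v ⟩
    0ℚ                                 ∎

  primitive⇒coef[] : ∀ p → IsPrimitive p → coef p [] ≡ 0ℚ
  primitive⇒coef[] p isPrim = begin
    x              ≡⟨ solve 1 (λ x → x := (x :+ x) :+ (:- x)) refl x ⟩
    (x + x) + (- x) ≡⟨ cong (_+ (- x)) (trans (sym (prim-[] p)) (trans (sym (isPrim ([] , []))) (coef₂-Δ p [] []))) ⟩
    x + (- x)       ≡⟨ ℚ.+-inverseʳ x ⟩
    0ℚ              ∎
    where x = coef p []

  alternal⇒primitive : ∀ p → coef p [] ≡ 0ℚ → Alternal (coef p) → IsPrimitive p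
  alternal⇒primitive p p[] alt (u , v) = trans (coef₂-Δ p u v) (cases u v)
    where
    cases : ∀ u v → sh (coef p) u v ≡ coef₂ (prim p) (u , v)
    cases []      []      = trans p[] (sym (trans (prim-[] p) (cong₂ _+_ p[] p[])))
    cases []      (b ∷ v) = sym (prim-[]ˡ p b v)
    cases (a ∷ u) []      = sym (prim-[]ʳ p a u)
    cases (a ∷ u) (b ∷ v) = trans (alt (a ∷ u) (b ∷ v) (λ ()) (λ ())) (sym (prim-∷∷ p a u b v))

  primitive⇒pair : ∀ p → IsPrimitive p → ∀ H →
    ⟨ p , (λ w → ⟨ Δword w , H ⟩) ⟩ ≡ ⟨ p , (λ w → H (w , []) + H ([] , w)) ⟩
  primitive⇒pair p isPrim H = trans (sym (pair-Δ p H)) (trans (coeff⇒pair pairEq (Δ p) (prim p) isPrim H) (pair-prim p H))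

  pair⇒primitive : ∀ p → (∀ H → ⟨ p , (λ w → ⟨ Δword w , H ⟩) ⟩ ≡ ⟨ p , (λ w → H (w , []) + H ([] , w)) ⟩) → IsPrimitive p
  pair⇒primitive p e = pair⇒coeff pairEq (Δ p) (prim p) (λ H → trans (pair-Δ p H) (trans (e H) (sym (pair-prim p H))))

  -- Letters are primitive, and proper shuffles have length at least two, so primitivity leaves
  -- one-letter coefficients free.
  primitive-cong : ∀ p q → (∀ w → length w ≢ 1 → coef p w ≡ coef q w) → IsPrimitive p → IsPrimitive q
  primitive-cong p q e isPrim = alternal⇒primitive q (trans (sym (e [] (λ ()))) (primitive⇒coef[] p isPrim)) alt
    where
    alt : Alternal (coef q)
    alt []      v       u≢ v≢ = ⊥-elim (u≢ refl)
    alt (_ ∷ _) []      u≢ v≢ = ⊥-elim (v≢ refl)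
    alt (a ∷ u) (b ∷ v) u≢ v≢ = trans
      (sh-cong-length (a ∷ u) (b ∷ v) (λ w l → sym (e w (λ l₁ → long (trans (sym l₁) l)))))
      (primitive⇒alternal p isPrim (a ∷ u) (b ∷ v) u≢ v≢)
      where
      long : 1 ≢ suc (length u) ℕ.+ suc (length v)
      long l with trans (ℕP.suc-injective l) (ℕP.+-suc (length u) (length v))
      ... | ()

module XP = FreeAlgProps _≟X_
module YP = FreeAlgProps ℕ._≟_

-- The projection π_Y and its transpose

πword-x₀ : ∀ k w → πword k (x₀ ∷ w) ≡ πword (suc k) w
πword-x₀ zero    w = refl
πword-x₀ (suc k) w = refl

πword-x₁ : ∀ k w → πword k (x₁ ∷ w) ≡ Maybe.map (k ∷_) (πword 0 w)
πword-x₁ zero    w with πword 0 w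
... | just _  = refl
... | nothing = refl
πword-x₁ (suc k) w with πword 0 w
... | just _  = refl
... | nothing = refl

πword-block : ∀ k n w → πword k (replicate n x₀ ++ x₁ ∷ w) ≡ Maybe.map ((n ℕ.+ k) ∷_) (πword 0 w)
πword-block k zero    w = πword-x₁ k w
πword-block k (suc n) w = trans (πword-x₀ k _) (trans (πword-block (suc k) n w)
  (cong (λ m → Maybe.map (m ∷_) (πword 0 w)) (ℕP.+-suc n k)))

πword-ι : ∀ v → πword 0 (ιword v) ≡ just v
πword-ι []      = refl
πword-ι (n ∷ v) = begin
  πword 0 (ιword (n ∷ v))                          ≡⟨ cong (πword 0) (ι-∷ n v) ⟩
  πword 0 (replicate n x₀ ++ x₁ ∷ ιword v)         ≡⟨ πword-block 0 n (ιword v) ⟩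
  Maybe.map ((n ℕ.+ 0) ∷_) (πword 0 (ιword v))     ≡⟨ cong₂ (λ m → Maybe.map (m ∷_)) (ℕP.+-identityʳ n) (πword-ι v) ⟩
  just (n ∷ v)                                     ∎

ι-injective : ∀ {v w} → ιword v ≡ ιword w → v ≡ w
ι-injective {v} {w} e = just-injective (trans (sym (πword-ι v)) (trans (cong (πword 0) e) (πword-ι w)))

-- π_Y is not multiplicative, since a prefix ending in x₀ is sent to zero. Once the prefix is closed
-- by x₁, π_Y commutes with right multiplication by words of ℚ⟨Y⟩.
πword-++ : ∀ k t v → πword k (t ++ x₁ ∷ ιword v) ≡ Maybe.map (_++ v) (πword k (t ∷ʳ x₁))
πword-++ k []       v = trans (πword-x₁ k (ιword v)) (trans (cong (Maybe.map (k ∷_)) (πword-ι v))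
  (cong (Maybe.map (_++ v)) (sym (πword-x₁ k []))))
πword-++ k (x₀ ∷ t) v = trans (πword-x₀ k _) (trans (πword-++ (suc k) t v) (cong (Maybe.map (_++ v)) (sym (πword-x₀ k (t ∷ʳ x₁)))))
πword-++ k (x₁ ∷ t) v = begin
  πword k (x₁ ∷ t ++ x₁ ∷ ιword v)                                ≡⟨ πword-x₁ k _ ⟩
  Maybe.map (k ∷_) (πword 0 (t ++ x₁ ∷ ιword v))                  ≡⟨ cong (Maybe.map (k ∷_)) (πword-++ 0 t v) ⟩
  Maybe.map (k ∷_) (Maybe.map (_++ v) (πword 0 (t ∷ʳ x₁)))        ≡⟨ swap (πword 0 (t ∷ʳ x₁)) ⟩
  Maybe.map (_++ v) (Maybe.map (k ∷_) (πword 0 (t ∷ʳ x₁)))        ≡⟨ cong (Maybe.map (_++ v)) (πword-x₁ k (t ∷ʳ x₁)) ⟨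
  Maybe.map (_++ v) (πword k (x₁ ∷ t ∷ʳ x₁))                      ∎
  where
  swap : ∀ m → Maybe.map (k ∷_) (Maybe.map (_++ v) m) ≡ Maybe.map (_++ v) (Maybe.map (k ∷_) m)
  swap (just _) = refl
  swap nothing  = refl

replicate-+ : ∀ {A : Set} m n (x : A) → replicate (m ℕ.+ n) x ≡ replicate m x ++ replicate n x
replicate-+ zero    n x = refl
replicate-+ (suc m) n x = cong (x ∷_) (replicate-+ m n x)

πword-just : ∀ k z {v} → πword k z ≡ just v → replicate k x₀ ++ z ≡ ιword v
πword-just zero    []       refl = refl
πword-just (suc k) []       ()
πword-just k       (x₀ ∷ z) e    = trans (sym (++-assoc (replicate k x₀) [ x₀ ] z))
  (trans (cong (_++ z) (replicate-∷ʳ k)) (πword-just (suc k) z (trans (sym (πword-x₀ k z)) e)))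
πword-just k       (x₁ ∷ z) e    with πword 0 z in eq | trans (sym (πword-x₁ k z)) e
... | just v  | refl = trans (cong (λ t → replicate k x₀ ++ x₁ ∷ t) (πword-just 0 z eq)) (sym (ι-∷ k v))
... | nothing | ()

-- The transpose of π_Y on functionals.
π* : (List LetterY → ℚ) → List LetterX → ℚ
π* H w = maybe′ H 0ℚ (πword 0 w)

pair-πY : ∀ p H → ⟨ πY p , H ⟩ ≡ ⟨ p , π* H ⟩
pair-πY []            H = refl
pair-πY ((c , w) ∷ p) H with πword 0 w
... | just v  = cong₂ _+_ (cong (_* H v) (ℚ.*-identityʳ c)) (pair-πY p H)
... | nothing = trans (pair-πY p H) (sym (trans (cong (_+ ⟨ p , π* H ⟩) (ℚ.*-zeroʳ c)) (ℚ.+-identityˡ _)))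

π*-map : ∀ H g z z′ → πword 0 z ≡ Maybe.map g (πword 0 z′) → π* H z ≡ π* (H ∘ g) z′
π*-map H g z z′ e rewrite e with πword 0 z′
... | just _  = refl
... | nothing = refl

π*-∷ : ∀ H n t → π* H (replicate n x₀ ++ x₁ ∷ t) ≡ π* (H ∘ (n ∷_)) t
π*-∷ H n t = π*-map H (n ∷_) (replicate n x₀ ++ x₁ ∷ t) t
  (trans (πword-block 0 n t) (cong (λ m → Maybe.map (m ∷_) (πword 0 t)) (ℕP.+-identityʳ n)))

π*-++ : ∀ H t v → π* H (t ++ x₁ ∷ ιword v) ≡ π* (H ∘ (_++ v)) (t ∷ʳ x₁)
π*-++ H t v = π*-map H (_++ v) (t ++ x₁ ∷ ιword v) (t ∷ʳ x₁) (πword-++ 0 t v)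

π*-δ : ∀ w z → π* (δ Y.wordEq w) z ≡ δ X.wordEq (ιword w) z
π*-δ w z = by (πword 0 z) refl
  where
  by : ∀ m → πword 0 z ≡ m → maybe′ (δ Y.wordEq w) 0ℚ m ≡ δ X.wordEq (ιword w) z
  by (just v) e = trans (sym (δ-injective Y.wordEq X.wordEq ιword ι-injective w v))
    (cong (δ X.wordEq (ιword w)) (sym (πword-just 0 z e)))
  by nothing  e = sym (δ-≢ X.wordEq (ιword w) z λ { refl → absurd (trans (sym e) (πword-ι w)) })
    where
    absurd : nothing ≢ just w
    absurd ()

coef-πY : ∀ p w → Y.coef (πY p) w ≡ X.coef p (ιword w)
coef-πY p w = begin
  Y.coef (πY p) w                    ≡⟨ coeff-pair Y.wordEq (πY p) w ⟩
  ⟨ πY p , δ Y.wordEq w ⟩            ≡⟨ pair-πY p (δ Y.wordEq w) ⟩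
  ⟨ p , π* (δ Y.wordEq w) ⟩          ≡⟨ pair-cong p (π*-δ w) ⟩
  ⟨ p , δ X.wordEq (ιword w) ⟩       ≡⟨ coeff-pair X.wordEq p (ιword w) ⟨
  X.coef p (ιword w)                 ∎

-- Recursion for s_ψ and s^Y_ψ

module _ (ψ : PolyX) where

  private
    s : List LetterX → (List LetterX → ℚ) → ℚ
    s z K = ⟨ ψ , (λ u → K (u ++ z)) ⟩ + ⟨ dword ψ z , K ⟩

    pair-sψ : ∀ z K → ⟨ sψ ψ (X.word z) , K ⟩ ≡ s z K
    pair-sψ z K = trans (pair-++ (X.mul ψ (X.word z)) (dψ ψ (X.word z)) K)
      (cong₂ _+_ (XP.pair-mul-word ψ z K) (trans (pair-extend (dword ψ) (X.word z) K) (pair-single z (λ b → ⟨ dword ψ b , K ⟩))))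

    pair-dword-∷ : ∀ a z K → ⟨ dword ψ (a ∷ z) , K ⟩ ≡ ⟨ dLetter ψ a , (λ u → K (u ++ z)) ⟩ + ⟨ dword ψ z , K ∘ (a ∷_) ⟩
    pair-dword-∷ a z K = trans (pair-++ (X.mul (dLetter ψ a) (X.word z)) _ K)
      (cong₂ _+_ (XP.pair-mul-word (dLetter ψ a) z K) (XP.pair-word-mul [ a ] (dword ψ z) K))

    pair-dx₁ : ∀ K → ⟨ dLetter ψ x₁ , K ⟩ ≡ ⟨ ψ , K ∘ (x₁ ∷_) ⟩ + (- 1ℚ) * ⟨ ψ , K ∘ (_∷ʳ x₁) ⟩
    pair-dx₁ K = trans (XP.pair-⊖ (X.mul (X.word [ x₁ ]) ψ) (X.mul ψ (X.word [ x₁ ])) K)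
      (cong₂ (λ p q → p + (- 1ℚ) * q) (XP.pair-word-mul [ x₁ ] ψ K) (XP.pair-mul-word ψ [ x₁ ] K))

    -- As d_ψ kills x₀, moving x₀ out of s_ψ costs only the commutator: s_ψ(x₀ z) = x₀ s_ψ(z) +
    -- [ψ, x₀] z.
    s-x₀ : ∀ z K → s (x₀ ∷ z) K
      ≡ s z (K ∘ (x₀ ∷_)) + (⟨ ψ , (λ u → K (u ++ x₀ ∷ z)) ⟩ + (- 1ℚ) * ⟨ ψ , (λ u → K (x₀ ∷ u ++ z)) ⟩)
    s-x₀ z K = trans (cong (⟨ ψ , (λ u → K (u ++ x₀ ∷ z)) ⟩ +_) (pair-dword-∷ x₀ z K))
      (solve 3 (λ p q d → p :+ (con 0ℚ :+ d) := (q :+ d) :+ (p :+ con (- 1ℚ) :* q)) refl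
        ⟨ ψ , (λ u → K (u ++ x₀ ∷ z)) ⟩ ⟨ ψ , (λ u → K (x₀ ∷ u ++ z)) ⟩ ⟨ dword ψ z , K ∘ (x₀ ∷_) ⟩)

    -- ψ x₁ + [x₁, ψ] = x₁ ψ, so s_ψ commutes with left multiplication by x₁.
    s-x₁ : ∀ z K → s (x₁ ∷ z) K ≡ s z (K ∘ (x₁ ∷_))
    s-x₁ z K = begin
      p + ⟨ dword ψ (x₁ ∷ z) , K ⟩   ≡⟨ cong (p +_) (trans (pair-dword-∷ x₁ z K) (cong (_+ d) (pair-dx₁ (λ u → K (u ++ z))))) ⟩
      p + ((q + (- 1ℚ) * ⟨ ψ , (λ u → K ((u ∷ʳ x₁) ++ z)) ⟩) + d)
        ≡⟨ cong (λ y → p + ((q + (- 1ℚ) * y) + d)) (pair-cong ψ (λ u → cong K (++-assoc u [ x₁ ] z))) ⟩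
      p + ((q + (- 1ℚ) * p) + d)
        ≡⟨ solve 3 (λ p q d → p :+ ((q :+ con (- 1ℚ) :* p) :+ d) := q :+ d) refl p q d ⟩
      q + d ∎
      where
      p = ⟨ ψ , (λ u → K (u ++ x₁ ∷ z)) ⟩
      q = ⟨ ψ , (λ u → K (x₁ ∷ u ++ z)) ⟩
      d = ⟨ dword ψ z , K ∘ (x₁ ∷_) ⟩

    s-block : ∀ n z K → s (replicate n x₀ ++ x₁ ∷ z) K
      ≡ s z (λ u → K (replicate n x₀ ++ x₁ ∷ u))
        + (⟨ ψ , (λ u → K (u ++ replicate n x₀ ++ x₁ ∷ z)) ⟩ + (- 1ℚ) * ⟨ ψ , (λ u → K (replicate n x₀ ++ u ++ x₁ ∷ z)) ⟩)
    s-block zero    z K = trans (s-x₁ z K)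
      (solve 2 (λ x y → x := x :+ (y :+ con (- 1ℚ) :* y)) refl (s z (K ∘ (x₁ ∷_))) ⟨ ψ , (λ u → K (u ++ x₁ ∷ z)) ⟩)
    s-block (suc n) z K = trans (s-x₀ (replicate n x₀ ++ x₁ ∷ z) K)
      (trans (cong (_+ (p + (- 1ℚ) * q)) (s-block n z (K ∘ (x₀ ∷_))))
        (solve 4 (λ x p q r → (x :+ (q :+ con (- 1ℚ) :* r)) :+ (p :+ con (- 1ℚ) :* q) := x :+ (p :+ con (- 1ℚ) :* r)) refl
          (s z (λ u → K (x₀ ∷ replicate n x₀ ++ x₁ ∷ u))) p q ⟨ ψ , (λ u → K (x₀ ∷ replicate n x₀ ++ u ++ x₁ ∷ z)) ⟩))
      where
      p = ⟨ ψ , (λ u → K (u ++ x₀ ∷ replicate n x₀ ++ x₁ ∷ z)) ⟩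
      q = ⟨ ψ , (λ u → K (x₀ ∷ u ++ replicate n x₀ ++ x₁ ∷ z)) ⟩

  PX QX : ℕ → PolyX
  PX n = X.mul ψ (X.word (replicate n x₀ ∷ʳ x₁))
  QX n = X.mul (X.word (replicate n x₀)) (X.mul ψ (X.word [ x₁ ]))

  -- D n = [ψ , x₀ⁿ] x₁
  D : ℕ → PolyY
  D n = πY (PX n X.⊖ QX n)

  pair-D : ∀ n H → ⟨ D n , H ⟩
    ≡ ⟨ ψ , (λ u → π* H (u ++ replicate n x₀ ∷ʳ x₁)) ⟩ + (- 1ℚ) * ⟨ ψ , (λ u → π* H (replicate n x₀ ++ u ∷ʳ x₁)) ⟩
  pair-D n H = begin
    ⟨ D n , H ⟩ ≡⟨ pair-πY (PX n X.⊖ QX n) H ⟩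
    ⟨ PX n X.⊖ QX n , π* H ⟩ ≡⟨ XP.pair-⊖ (PX n) (QX n) (π* H) ⟩
    ⟨ PX n , π* H ⟩ + (- 1ℚ) * ⟨ QX n , π* H ⟩
      ≡⟨ cong₂ (λ p q → p + (- 1ℚ) * q) (XP.pair-mul-word ψ (replicate n x₀ ∷ʳ x₁) (π* H))
           (trans (XP.pair-word-mul (replicate n x₀) (X.mul ψ (X.word [ x₁ ])) (π* H)) (XP.pair-mul-word ψ [ x₁ ] (λ u → π* H (replicate n x₀ ++ u)))) ⟩
    _ ∎

  -- s^Y_ψ is right multiplication by π_Y(ψ) plus the derivation y_{n+1} ↦ D n.
  sY-[] : ∀ H → ⟨ sYψ ψ [] , H ⟩ ≡ ⟨ πY ψ , H ⟩
  sY-[] H = begin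
    ⟨ sYψ ψ [] , H ⟩                               ≡⟨ pair-πY (sψ ψ (X.word [])) H ⟩
    ⟨ sψ ψ (X.word []) , π* H ⟩                    ≡⟨ pair-sψ [] (π* H) ⟩
    ⟨ ψ , (λ u → π* H (u ++ [])) ⟩ + 0ℚ            ≡⟨ ℚ.+-identityʳ _ ⟩
    ⟨ ψ , (λ u → π* H (u ++ [])) ⟩                 ≡⟨ pair-cong ψ (λ u → cong (π* H) (++-identityʳ u)) ⟩
    ⟨ ψ , π* H ⟩                                   ≡⟨ pair-πY ψ H ⟨
    ⟨ πY ψ , H ⟩                                   ∎

  sY-∷ : ∀ n v H → ⟨ sYψ ψ (n ∷ v) , H ⟩ ≡ ⟨ sYψ ψ v , H ∘ (n ∷_) ⟩ + ⟨ D n , H ∘ (_++ v) ⟩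
  sY-∷ n v H = begin
    ⟨ sYψ ψ (n ∷ v) , H ⟩                          ≡⟨ pair-πY (sψ ψ (X.word (ιword (n ∷ v)))) H ⟩
    ⟨ sψ ψ (X.word (ιword (n ∷ v))) , π* H ⟩       ≡⟨ pair-sψ (ιword (n ∷ v)) (π* H) ⟩
    s (ιword (n ∷ v)) (π* H)                       ≡⟨ cong (λ z → s z (π* H)) (ι-∷ n v) ⟩
    s (replicate n x₀ ++ x₁ ∷ ιword v) (π* H)      ≡⟨ s-block n (ιword v) (π* H) ⟩
    s (ιword v) (λ u → π* H (replicate n x₀ ++ x₁ ∷ u))
      + (⟨ ψ , (λ u → π* H (u ++ replicate n x₀ ++ x₁ ∷ ιword v)) ⟩ + (- 1ℚ) * ⟨ ψ , (λ u → π* H (replicate n x₀ ++ u ++ x₁ ∷ ιword v)) ⟩)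
      ≡⟨ cong₂ _+_ first (cong₂ (λ p q → p + (- 1ℚ) * q) (pair-cong ψ second) (pair-cong ψ third)) ⟩
    ⟨ sYψ ψ v , H ∘ (n ∷_) ⟩
      + (⟨ ψ , (λ u → π* (H ∘ (_++ v)) (u ++ replicate n x₀ ∷ʳ x₁)) ⟩ + (- 1ℚ) * ⟨ ψ , (λ u → π* (H ∘ (_++ v)) (replicate n x₀ ++ u ∷ʳ x₁)) ⟩)
      ≡⟨ cong (⟨ sYψ ψ v , H ∘ (n ∷_) ⟩ +_) (pair-D n (H ∘ (_++ v))) ⟨
    ⟨ sYψ ψ v , H ∘ (n ∷_) ⟩ + ⟨ D n , H ∘ (_++ v) ⟩ ∎
    where
    first : s (ιword v) (λ u → π* H (replicate n x₀ ++ x₁ ∷ u)) ≡ ⟨ sYψ ψ v , H ∘ (n ∷_) ⟩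
    first = begin
      s (ιword v) (λ u → π* H (replicate n x₀ ++ x₁ ∷ u))
        ≡⟨ cong₂ _+_ (pair-cong ψ (λ u → π*-∷ H n (u ++ ιword v))) (pair-cong (dword ψ (ιword v)) (π*-∷ H n)) ⟩
      s (ιword v) (π* (H ∘ (n ∷_)))                         ≡⟨ pair-sψ (ιword v) (π* (H ∘ (n ∷_))) ⟨
      ⟨ sψ ψ (X.word (ιword v)) , π* (H ∘ (n ∷_)) ⟩         ≡⟨ pair-πY (sψ ψ (X.word (ιword v))) (H ∘ (n ∷_)) ⟨
      ⟨ sYψ ψ v , H ∘ (n ∷_) ⟩                              ∎
    second : ∀ u → π* H (u ++ replicate n x₀ ++ x₁ ∷ ιword v) ≡ π* (H ∘ (_++ v)) (u ++ replicate n x₀ ∷ʳ x₁)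
    second u = begin
      π* H (u ++ replicate n x₀ ++ x₁ ∷ ιword v)            ≡⟨ cong (π* H) (++-assoc u (replicate n x₀) (x₁ ∷ ιword v)) ⟨
      π* H ((u ++ replicate n x₀) ++ x₁ ∷ ιword v)          ≡⟨ π*-++ H (u ++ replicate n x₀) v ⟩
      π* (H ∘ (_++ v)) ((u ++ replicate n x₀) ∷ʳ x₁)        ≡⟨ cong (π* (H ∘ (_++ v))) (++-assoc u (replicate n x₀) [ x₁ ]) ⟩
      π* (H ∘ (_++ v)) (u ++ replicate n x₀ ∷ʳ x₁)          ∎
    third : ∀ u → π* H (replicate n x₀ ++ u ++ x₁ ∷ ιword v) ≡ π* (H ∘ (_++ v)) (replicate n x₀ ++ u ∷ʳ x₁)
    third u = begin
      π* H (replicate n x₀ ++ u ++ x₁ ∷ ιword v)            ≡⟨ cong (π* H) (++-assoc (replicate n x₀) u (x₁ ∷ ιword v)) ⟨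
      π* H ((replicate n x₀ ++ u) ++ x₁ ∷ ιword v)          ≡⟨ π*-++ H (replicate n x₀ ++ u) v ⟩
      π* (H ∘ (_++ v)) ((replicate n x₀ ++ u) ∷ʳ x₁)        ≡⟨ cong (π* (H ∘ (_++ v))) (++-assoc (replicate n x₀) u [ x₁ ]) ⟩
      π* (H ∘ (_++ v)) (replicate n x₀ ++ u ∷ʳ x₁)          ∎

  -- The stabiliser condition tested on functionals

  private
    Functional₂ : Set
    Functional₂ = List LetterY × List LetterY → ℚ

    Δ* : Functional₂ → List LetterY → ℚ
    Δ* H w = ⟨ Y.Δword w , H ⟩

    s₂ : Functional₂ → Functional₂
    s₂ H (v , w) = ⟨ sYψ ψ v , (λ v′ → H (v′ , w)) ⟩ + ⟨ sYψ ψ w , (λ w′ → H (v , w′)) ⟩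

    -- Transpose of left multiplication by D n ⊗ 1 + 1 ⊗ D n: by `s₂-split`, the commutator of s^Y ⊗
    -- id + id ⊗ s^Y with y ⊗ 1 + 1 ⊗ y for the letter y coded by `n`.
    d₂ : ℕ → Functional₂ → Functional₂
    d₂ n H (v , w) = ⟨ D n , (λ u → H (u ++ v , w) + H (v , u ++ w)) ⟩

    CoderivationAt : List LetterY → Set
    CoderivationAt v = ∀ H → ⟨ Y.Δword v , s₂ H ⟩ ≡ ⟨ sYψ ψ v , Δ* H ⟩

    leibniz : List LetterY → Tensor LetterY
    leibniz v = (sYψ ψ Y.⊗id) (Y.Δword v) ++ (Y.id⊗ sYψ ψ) (Y.Δword v)

    StabAt : List LetterY → Set
    StabAt v = leibniz v Y.≈₂ Y.Δ (sYψ ψ v)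

    pair-leibniz : ∀ v H → ⟨ leibniz v , H ⟩ ≡ ⟨ Y.Δword v , s₂ H ⟩
    pair-leibniz v H = begin
      _ ≡⟨ pair-++ ((sYψ ψ Y.⊗id) (Y.Δword v)) ((Y.id⊗ sYψ ψ) (Y.Δword v)) H ⟩
      _ ≡⟨ cong₂ _+_ (YP.pair-⊗id (sYψ ψ) (Y.Δword v) H) (YP.pair-id⊗ (sYψ ψ) (Y.Δword v) H) ⟩
      _ ≡⟨ pair-+ (Y.Δword v) (λ (v , w) → ⟨ sYψ ψ v , (λ v′ → H (v′ , w)) ⟩) (λ (v , w) → ⟨ sYψ ψ w , (λ w′ → H (v , w′)) ⟩) ⟨
      _ ∎

    stab⇒coderivation : ∀ v → StabAt v → CoderivationAt v
    stab⇒coderivation v e H = trans (sym (pair-leibniz v H))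
      (trans (coeff⇒pair Y.pairEq (leibniz v) (Y.Δ (sYψ ψ v)) e H) (YP.pair-Δ (sYψ ψ v) H))

    coderivation⇒stab : ∀ v → CoderivationAt v → StabAt v
    coderivation⇒stab v e = pair⇒coeff Y.pairEq (leibniz v) (Y.Δ (sYψ ψ v))
      (λ H → trans (pair-leibniz v H) (trans (e H) (sym (YP.pair-Δ (sYψ ψ v) H))))

    s₂-split : ∀ n H t → YP.split n (s₂ H) t ≡ s₂ (YP.split n H) t + d₂ n H t
    s₂-split n H (v , w) = begin
      (⟨ sYψ ψ (n ∷ v) , (λ v′ → H (v′ , w)) ⟩ + c) + (b + ⟨ sYψ ψ (n ∷ w) , (λ w′ → H (v , w′)) ⟩)
        ≡⟨ cong₂ (λ p q → (p + c) + (b + q)) (sY-∷ n v (λ v′ → H (v′ , w))) (sY-∷ n w (λ w′ → H (v , w′))) ⟩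
      ((a + e) + c) + (b + (d + f))
        ≡⟨ solve 6 (λ a b c d e f → ((a :+ e) :+ c) :+ (b :+ (d :+ f)) := ((a :+ b) :+ (c :+ d)) :+ (e :+ f)) refl a b c d e f ⟩
      ((a + b) + (c + d)) + (e + f)
        ≡⟨ cong₂ _+_ (cong₂ _+_ (pair-+ (sYψ ψ v) (λ v′ → H (n ∷ v′ , w)) (λ v′ → H (v′ , n ∷ w)))
                                (pair-+ (sYψ ψ w) (λ w′ → H (n ∷ v , w′)) (λ w′ → H (v , n ∷ w′))))
                     (pair-+ (D n) (λ u → H (u ++ v , w)) (λ u → H (v , u ++ w))) ⟨
      s₂ (YP.split n H) (v , w) + d₂ n H (v , w) ∎
      where
      a = ⟨ sYψ ψ v , (λ v′ → H (n ∷ v′ , w)) ⟩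
      b = ⟨ sYψ ψ v , (λ v′ → H (v′ , n ∷ w)) ⟩
      c = ⟨ sYψ ψ w , (λ w′ → H (n ∷ v , w′)) ⟩
      d = ⟨ sYψ ψ w , (λ w′ → H (v , n ∷ w′)) ⟩
      e = ⟨ D n , (λ u → H (u ++ v , w)) ⟩
      f = ⟨ D n , (λ u → H (v , u ++ w)) ⟩

    -- The part of the induction step that does not involve primitivity of `D n`, so that both
    -- directions of the equivalence can use it.
    coderivation-left : ∀ n v → CoderivationAt v → ∀ H →
      ⟨ Y.Δword (n ∷ v) , s₂ H ⟩ ≡ ⟨ sYψ ψ v , Δ* H ∘ (n ∷_) ⟩ + ⟨ Y.Δword v , d₂ n H ⟩
    coderivation-left n v cod H = begin
      ⟨ Y.Δword (n ∷ v) , s₂ H ⟩                                     ≡⟨ YP.pair-Δ-∷ n v (s₂ H) ⟩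
      ⟨ Y.Δword v , YP.split n (s₂ H) ⟩                              ≡⟨ pair-cong (Y.Δword v) (s₂-split n H) ⟩
      ⟨ Y.Δword v , (λ t → s₂ (YP.split n H) t + d₂ n H t) ⟩         ≡⟨ pair-+ (Y.Δword v) (s₂ (YP.split n H)) (d₂ n H) ⟩
      ⟨ Y.Δword v , s₂ (YP.split n H) ⟩ + ⟨ Y.Δword v , d₂ n H ⟩     ≡⟨ cong (_+ ⟨ Y.Δword v , d₂ n H ⟩) (cod (YP.split n H)) ⟩
      ⟨ sYψ ψ v , Δ* (YP.split n H) ⟩ + ⟨ Y.Δword v , d₂ n H ⟩       ≡⟨ cong (_+ ⟨ Y.Δword v , d₂ n H ⟩) (pair-cong (sYψ ψ v) (λ w → YP.pair-Δ-∷ n w H)) ⟨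
      ⟨ sYψ ψ v , Δ* H ∘ (n ∷_) ⟩ + ⟨ Y.Δword v , d₂ n H ⟩           ∎

    -- In Δ(D n · v) = Δ(D n) Δ(v) primitivity replaces the first factor by D n ⊗ 1 + 1 ⊗ D n. The
    -- functional `G` absorbs the factor Δ(v).
    d₂-coderivation : ∀ n v → Y.IsPrimitive (D n) → ∀ H → ⟨ Y.Δword v , d₂ n H ⟩ ≡ ⟨ D n , Δ* H ∘ (_++ v) ⟩
    d₂-coderivation n v isPrim H = begin
      ⟨ Y.Δword v , d₂ n H ⟩
        ≡⟨ pair-swap (Y.Δword v) (D n) (λ (v₁ , v₂) u → H (u ++ v₁ , v₂) + H (v₁ , u ++ v₂)) ⟩
      ⟨ D n , (λ u → ⟨ Y.Δword v , (λ (v₁ , v₂) → H (u ++ v₁ , v₂) + H (v₁ , u ++ v₂)) ⟩) ⟩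
        ≡⟨ pair-cong (D n) (λ u → pair-+ (Y.Δword v) (λ (v₁ , v₂) → H (u ++ v₁ , v₂)) (λ (v₁ , v₂) → H (v₁ , u ++ v₂))) ⟩
      ⟨ D n , (λ u → G (u , []) + G ([] , u)) ⟩
        ≡⟨ YP.primitive⇒pair (D n) isPrim G ⟨
      ⟨ D n , (λ u → ⟨ Y.Δword u , G ⟩) ⟩
        ≡⟨ pair-cong (D n) (λ u → YP.pair-Δ-++ u v H) ⟨
      ⟨ D n , Δ* H ∘ (_++ v) ⟩ ∎
      where
      G : Functional₂
      G (u₁ , u₂) = ⟨ Y.Δword v , (λ (v₁ , v₂) → H (u₁ ++ v₁ , u₂ ++ v₂)) ⟩

    coderivation-[] : ∀ H → ⟨ Y.Δword [] , s₂ H ⟩ ≡ ⟨ πY ψ , (λ w → H (w , []) + H ([] , w)) ⟩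
    coderivation-[] H = begin
      ⟨ Y.Δword [] , s₂ H ⟩                                                ≡⟨ pair-single ([] , []) (s₂ H) ⟩
      s₂ H ([] , [])                                                       ≡⟨ pair-+ (sYψ ψ []) (λ w → H (w , [])) (λ w → H ([] , w)) ⟨
      ⟨ sYψ ψ [] , (λ w → H (w , []) + H ([] , w)) ⟩                       ≡⟨ sY-[] _ ⟩
      ⟨ πY ψ , (λ w → H (w , []) + H ([] , w)) ⟩                           ∎

  primitive⇒stab : Y.IsPrimitive (πY ψ) → (∀ n → Y.IsPrimitive (D n)) → ∀ v → StabAt v
  primitive⇒stab primπ primD v = coderivation⇒stab v (go v)
    where
    go : ∀ v → CoderivationAt v
    go []      H = trans (coderivation-[] H) (trans (sym (YP.primitive⇒pair (πY ψ) primπ H)) (sym (sY-[] (Δ* H))))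
    go (n ∷ v) H = trans (coderivation-left n v (go v) H)
      (trans (cong (⟨ sYψ ψ v , Δ* H ∘ (n ∷_) ⟩ +_) (d₂-coderivation n v (primD n) H)) (sym (sY-∷ n v (Δ* H))))

  -- The condition at the empty word, because s^Y_ψ(1) = π_Y(ψ).
  stab⇒primitive : (∀ v → StabAt v) → Y.IsPrimitive (πY ψ)
  stab⇒primitive stab = YP.pair⇒primitive (πY ψ)
    (λ H → trans (sym (sY-[] (Δ* H))) (trans (sym (stab⇒coderivation [] (stab []) H)) (coderivation-[] H)))

  -- The condition at a one-letter word; the contribution of π_Y(ψ) occurs on both sides and
  -- cancels.
  stab⇒primitiveD : (∀ v → StabAt v) → ∀ n → Y.IsPrimitive (D n)
  stab⇒primitiveD stab n = YP.pair⇒primitive (D n) (λ H → begin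
    ⟨ D n , Δ* H ⟩
      ≡⟨ pair-cong (D n) (λ u → cong (Δ* H) (sym (++-identityʳ u))) ⟩
    ⟨ D n , Δ* H ∘ (_++ []) ⟩
      ≡⟨ ∙-cancelˡ ⟨ sYψ ψ [] , Δ* H ∘ (n ∷_) ⟩ _ _ (trans (sym (sY-∷ n [] (Δ* H)))
           (trans (sym (stab⇒coderivation (n ∷ []) (stab (n ∷ [])) H)) (coderivation-left n [] (stab⇒coderivation [] (stab [])) H))) ⟩
    ⟨ Y.Δword [] , d₂ n H ⟩
      ≡⟨ pair-single ([] , []) (d₂ n H) ⟩
    ⟨ D n , (λ u → H (u ++ [] , []) + H ([] , u ++ [])) ⟩
      ≡⟨ pair-cong (D n) (λ u → cong (λ w → H (w , []) + H ([] , w)) (++-identityʳ u)) ⟩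
    ⟨ D n , (λ u → H (u , []) + H ([] , u)) ⟩ ∎)

  -- Coefficients of [ψ, x₀ᵐ] x₁

  private
    F : List LetterX → ℚ
    F = X.coef ψ

    F∘J : List ℕ → ℚ
    F∘J = F ∘ J

    -- As generating functions, z_dᵐ f and z₀ᵐ f. Hence the cases below: an exponent of at least `m`
    -- is lowered by `m`, a smaller one gives zero.
    P Q : ℕ → List ℕ → ℚ
    P m w = X.coef (PX m) (ιword w)
    Q m w = X.coef (QX m) (ιword w)

    coef-D : ∀ m w → Y.coef (D m) w ≡ P m w + (- 1ℚ) * Q m w
    coef-D m w = trans (coef-πY (PX m X.⊖ QX m) w) (trans (coeff-++ X.wordEq (PX m) (scale (- 1ℚ) (QX m)) (ιword w))
      (cong (P m w +_) (coeff-scale X.wordEq (- 1ℚ) (QX m) (ιword w))))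

    coef-PX : ∀ m w → X.coef (PX m) w ≡ ⟨ ψ , (λ u → δ X.wordEq w (u ++ replicate m x₀ ∷ʳ x₁)) ⟩
    coef-PX m w = trans (coeff-pair X.wordEq (PX m) w) (XP.pair-mul-word ψ (replicate m x₀ ∷ʳ x₁) (δ X.wordEq w))

    coef-QX : ∀ m w → X.coef (QX m) w ≡ ⟨ ψ , (λ u → δ X.wordEq w (replicate m x₀ ++ u ∷ʳ x₁)) ⟩
    coef-QX m w = trans (coeff-pair X.wordEq (QX m) w)
      (trans (XP.pair-word-mul (replicate m x₀) (X.mul ψ (X.word [ x₁ ])) (δ X.wordEq w))
             (XP.pair-mul-word ψ [ x₁ ] (λ u → δ X.wordEq w (replicate m x₀ ++ u))))

    pair-δ-injective : ∀ g → (∀ {u v} → g u ≡ g v → u ≡ v) → ∀ w → ⟨ ψ , (λ u → δ X.wordEq (g w) (g u)) ⟩ ≡ F w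
    pair-δ-injective g inj w = trans (pair-cong ψ (δ-injective X.wordEq X.wordEq g inj w)) (sym (coeff-pair X.wordEq ψ w))

    pair-δ-≢ : ∀ (g : List LetterX → List LetterX) w → (∀ u → g u ≢ w) → ⟨ ψ , (λ u → δ X.wordEq w (g u)) ⟩ ≡ 0ℚ
    pair-δ-≢ g w ne = pair-0 ψ (λ u → δ-≢ X.wordEq w (g u) (ne u))

    P-≥ : ∀ m a w → P m (w ∷ʳ (m ℕ.+ a)) ≡ F∘J (w ∷ʳ a)
    P-≥ m a w = begin
      X.coef (PX m) (ιword (w ∷ʳ (m ℕ.+ a)))     ≡⟨ cong (X.coef (PX m)) word-eq ⟩
      X.coef (PX m) (g (J (w ∷ʳ a)))             ≡⟨ coef-PX m (g (J (w ∷ʳ a))) ⟩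
      _                                          ≡⟨ pair-δ-injective g (λ {u} {v} → ++-cancelʳ (replicate m x₀ ∷ʳ x₁) u v) (J (w ∷ʳ a)) ⟩
      F∘J (w ∷ʳ a)                                 ∎
      where
      g : List LetterX → List LetterX
      g u = u ++ replicate m x₀ ∷ʳ x₁
      word-eq : ιword (w ∷ʳ (m ℕ.+ a)) ≡ g (J (w ∷ʳ a))
      word-eq = begin
        ιword (w ∷ʳ (m ℕ.+ a))                                          ≡⟨ ι-∷ʳ w (m ℕ.+ a) ⟩
        ιword w ++ replicate (m ℕ.+ a) x₀ ∷ʳ x₁                         ≡⟨ cong (λ r → ιword w ++ r ∷ʳ x₁) (trans (cong (λ k → replicate k x₀) (ℕP.+-comm m a)) (replicate-+ a m x₀)) ⟩
        ιword w ++ (replicate a x₀ ++ replicate m x₀) ∷ʳ x₁             ≡⟨ cong (ιword w ++_) (++-assoc (replicate a x₀) (replicate m x₀) [ x₁ ]) ⟩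
        ιword w ++ replicate a x₀ ++ replicate m x₀ ∷ʳ x₁               ≡⟨ ++-assoc (ιword w) (replicate a x₀) (replicate m x₀ ∷ʳ x₁) ⟨
        (ιword w ++ replicate a x₀) ++ replicate m x₀ ∷ʳ x₁             ≡⟨ cong g (J-∷ʳ w a) ⟨
        g (J (w ∷ʳ a))                                                  ∎

    Q-≥ : ∀ m a w → Q m ((m ℕ.+ a) ∷ w) ≡ F∘J (a ∷ w)
    Q-≥ m a w = begin
      X.coef (QX m) (ιword ((m ℕ.+ a) ∷ w))      ≡⟨ cong (X.coef (QX m)) word-eq ⟩
      X.coef (QX m) (g (J (a ∷ w)))              ≡⟨ coef-QX m (g (J (a ∷ w))) ⟩
      _                                          ≡⟨ pair-δ-injective g (λ {u} {v} e → ++-cancelʳ [ x₁ ] u v (++-cancelˡ (replicate m x₀) _ _ e)) (J (a ∷ w)) ⟩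
      F∘J (a ∷ w)                                  ∎
      where
      g : List LetterX → List LetterX
      g u = replicate m x₀ ++ u ∷ʳ x₁
      word-eq : ιword ((m ℕ.+ a) ∷ w) ≡ g (J (a ∷ w))
      word-eq = begin
        ιword ((m ℕ.+ a) ∷ w)                                   ≡⟨ J-∷ʳx₁ (m ℕ.+ a) w ⟨
        (replicate (m ℕ.+ a) x₀ ++ κ w) ∷ʳ x₁                   ≡⟨ cong (λ r → (r ++ κ w) ∷ʳ x₁) (replicate-+ m a x₀) ⟩
        ((replicate m x₀ ++ replicate a x₀) ++ κ w) ∷ʳ x₁       ≡⟨ cong (_∷ʳ x₁) (++-assoc (replicate m x₀) (replicate a x₀) (κ w)) ⟩
        (replicate m x₀ ++ J (a ∷ w)) ∷ʳ x₁                     ≡⟨ ++-assoc (replicate m x₀) (J (a ∷ w)) [ x₁ ] ⟩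
        g (J (a ∷ w))                                           ∎

    replicate-split : ∀ a d → replicate (suc a ℕ.+ d) x₀ ≡ replicate a x₀ ++ x₀ ∷ replicate d x₀
    replicate-split a d = trans (cong (λ k → replicate k x₀) (sym (ℕP.+-suc a d))) (replicate-+ a (suc d) x₀)

    ι≢∷ʳx₀ : ∀ w u → u ∷ʳ x₀ ≢ ιword w
    ι≢∷ʳx₀ w u e with initLast w
    ... | []      = ∷ʳ≢[] u e
    ... | w ∷ʳ′ a with ∷ʳ-injectiveʳ u (ιword w ++ replicate a x₀) (trans e (trans (ι-∷ʳ w a) (sym (++-assoc (ιword w) (replicate a x₀) [ x₁ ]))))
    ...   | ()

    -- After cancelling the final x₀ᵃ x₁ the multiple of x₀ᵐ x₁ still ends in x₀, which no word in
    -- the image of `ιword` does.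
    P-< : ∀ a d w → P (suc a ℕ.+ d) (w ∷ʳ a) ≡ 0ℚ
    P-< a d w = trans (coef-PX m (ιword (w ∷ʳ a))) (pair-δ-≢ (_++ replicate m x₀ ∷ʳ x₁) (ιword (w ∷ʳ a)) λ u e →
      ι≢∷ʳx₀ w (u ++ replicate d x₀) (++-cancelʳ (replicate a x₀ ∷ʳ x₁) _ _ (begin
        ((u ++ replicate d x₀) ∷ʳ x₀) ++ replicate a x₀ ∷ʳ x₁     ≡⟨ cong (_++ replicate a x₀ ∷ʳ x₁) (++-assoc u (replicate d x₀) [ x₀ ]) ⟩
        (u ++ replicate d x₀ ∷ʳ x₀) ++ replicate a x₀ ∷ʳ x₁       ≡⟨ ++-assoc u (replicate d x₀ ∷ʳ x₀) (replicate a x₀ ∷ʳ x₁) ⟩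
        u ++ (replicate d x₀ ∷ʳ x₀) ++ replicate a x₀ ∷ʳ x₁       ≡⟨ cong (λ r → u ++ r ++ replicate a x₀ ∷ʳ x₁) (replicate-∷ʳ d) ⟩
        u ++ replicate (suc d) x₀ ++ replicate a x₀ ∷ʳ x₁         ≡⟨ cong (u ++_) (++-assoc (replicate (suc d) x₀) (replicate a x₀) [ x₁ ]) ⟨
        u ++ (replicate (suc d) x₀ ++ replicate a x₀) ∷ʳ x₁       ≡⟨ cong (λ r → u ++ r ∷ʳ x₁) (replicate-+ (suc d) a x₀) ⟨
        u ++ replicate (suc d ℕ.+ a) x₀ ∷ʳ x₁                     ≡⟨ cong (λ k → u ++ replicate (suc k) x₀ ∷ʳ x₁) (ℕP.+-comm d a) ⟩
        u ++ replicate m x₀ ∷ʳ x₁                                 ≡⟨ e ⟩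
        ιword (w ∷ʳ a)                                            ≡⟨ ι-∷ʳ w a ⟩
        ιword w ++ replicate a x₀ ∷ʳ x₁                           ∎)))
      where m = suc a ℕ.+ d

    Q-< : ∀ a d w → Q (suc a ℕ.+ d) (a ∷ w) ≡ 0ℚ
    Q-< a d w = trans (coef-QX m (ιword (a ∷ w))) (pair-δ-≢ (λ u → replicate m x₀ ++ u ∷ʳ x₁) (ιword (a ∷ w)) λ u e →
      absurd (++-cancelˡ (replicate a x₀) (x₀ ∷ replicate d x₀ ++ u ∷ʳ x₁) (x₁ ∷ ιword w) (begin
        replicate a x₀ ++ x₀ ∷ replicate d x₀ ++ u ∷ʳ x₁          ≡⟨ ++-assoc (replicate a x₀) (x₀ ∷ replicate d x₀) (u ∷ʳ x₁) ⟨
        (replicate a x₀ ++ x₀ ∷ replicate d x₀) ++ u ∷ʳ x₁        ≡⟨ cong (_++ u ∷ʳ x₁) (replicate-split a d) ⟨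
        replicate m x₀ ++ u ∷ʳ x₁                                 ≡⟨ e ⟩
        ιword (a ∷ w)                                             ≡⟨ ι-∷ a w ⟩
        replicate a x₀ ++ x₁ ∷ ιword w                            ∎)))
      where
      m = suc a ℕ.+ d
      absurd : ∀ {u v : List LetterX} → x₀ ∷ u ≢ x₁ ∷ v
      absurd ()

    coef-D-[] : ∀ m → Y.coef (D m) [] ≡ 0ℚ
    coef-D-[] m = trans (coef-D m []) (cong₂ (λ p q → p + (- 1ℚ) * q)
      (trans (coef-PX m []) (pair-δ-≢ (_++ replicate m x₀ ∷ʳ x₁) [] λ u e → ∷ʳ≢[] (u ++ replicate m x₀) (trans (++-assoc u (replicate m x₀) [ x₁ ]) e)))
      (trans (coef-QX m []) (pair-δ-≢ (λ u → replicate m x₀ ++ u ∷ʳ x₁) [] λ u e → ∷ʳ≢[] (replicate m x₀ ++ u) (trans (++-assoc (replicate m x₀) u [ x₁ ]) e))))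

    ≤-or-> : ∀ m a → (∃[ b ] m ℕ.+ b ≡ a) ⊎ (∃[ d ] suc a ℕ.+ d ≡ m)
    ≤-or-> m a with m ℕ.≤? a
    ... | yes m≤a = inj₁ (ℕP.m≤n⇒∃[o]m+o≡n m≤a)
    ... | no m≰a  = inj₂ (ℕP.m≤n⇒∃[o]m+o≡n (ℕP.≰⇒> m≰a))

  -- Condition (iv) indexed by the exponent k = n - 1. "Odd" refers to `k`; the weight `suc k` is
  -- even, hence at least 2.
  OddDepth1Vanishing : Set
  OddDepth1Vanishing = ∀ k → suc k ℕ.% 2 ≡ 0 → X.coef ψ (replicate k x₀ ∷ʳ x₁) ≡ 0ℚ

  module _ (isLie : IsLieX ψ) where

    private
      F[] = XP.primitive⇒coef[] ψ isLie
      altF = XP.primitive⇒alternal ψ isLie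

    primitiveD : Y.IsPrimitive (πY ψ) → OddDepth1Vanishing → ∀ m → Y.IsPrimitive (D m)
    primitiveD primπ odd m = YP.alternal⇒primitive (D m) (coef-D-[] m)
      (alternal-cong (coef-D m) (alternal-difference (P m) (Q m) altP altQ cyclicPQ))
      where
      altι : Alternal (F ∘ ιword)
      altι = alternal-cong (λ w → sym (coef-πY ψ w)) (YP.primitive⇒alternal (πY ψ) primπ)
      altP : ∀ a → Alternal (P m ∘ (_∷ʳ a))
      altP a with ≤-or-> m a
      ... | inj₁ (b , refl) = alternal-cong (P-≥ m b) (alternal-init F[] altF altι b)
      ... | inj₂ (d , refl) = alternal-0 (P-< a d)
      altQ : ∀ a → Alternal (Q m ∘ (a ∷_))
      altQ a with ≤-or-> m a
      ... | inj₁ (b , refl) = alternal-cong (Q-≥ m b) (alternal-tail F[] altF altι b)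
      ... | inj₂ (d , refl) = alternal-0 (Q-< a d)
      cyclicPQ : ∀ a w → w ≢ [] → P m (w ∷ʳ a) ≡ Q m (a ∷ w)
      cyclicPQ a w w≢ with ≤-or-> m a
      ... | inj₁ (b , refl) = trans (P-≥ m b w) (trans (cyclic F[] altF altι odd b w w≢) (sym (Q-≥ m b w)))
      ... | inj₂ (d , refl) = trans (P-< a d w) (sym (Q-< a d w))

    -- Shuffle y_{k+2} with y₁. In either order the exponent 0 of y₁ lies below m = 1 and kills one
    -- half of `D 1`; what remains is f(0, k) - f(k, 0).
    primitiveD1⇒odd : Y.IsPrimitive (D 1) → OddDepth1Vanishing
    primitiveD1⇒odd primD = symmetric⇒odd-depth1 F[] altF λ k → begin
      F∘J (0 ∷ k ∷ [])
        ≡⟨ solve 2 (λ x y → x := ((con 0ℚ :+ con (- 1ℚ) :* y) :+ (x :+ con (- 1ℚ) :* con 0ℚ)) :+ y) refl (F∘J (0 ∷ k ∷ [])) (F∘J (k ∷ 0 ∷ [])) ⟩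
      ((0ℚ + (- 1ℚ) * F∘J (k ∷ 0 ∷ [])) + (F∘J (0 ∷ k ∷ []) + (- 1ℚ) * 0ℚ)) + F∘J (k ∷ 0 ∷ [])
        ≡⟨ cong (_+ F∘J (k ∷ 0 ∷ [])) (trans (sym (cong₂ _+_ (coefs (P-< 0 0 [ suc k ]) (Q-≥ 1 k [ 0 ])) (coefs (P-≥ 1 k [ 0 ]) (Q-< 0 0 [ suc k ]))))
             (YP.primitive⇒alternal (D 1) primD [ suc k ] [ 0 ] (λ ()) (λ ()))) ⟩
      0ℚ + F∘J (k ∷ 0 ∷ [])  ≡⟨ ℚ.+-identityˡ _ ⟩
      F∘J (k ∷ 0 ∷ []) ∎
      where
      coefs : ∀ {w x y} → P 1 w ≡ x → Q 1 w ≡ y → Y.coef (D 1) w ≡ x + (- 1ℚ) * y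
      coefs {w} p q = trans (coef-D 1 w) (cong₂ (λ p q → p + (- 1ℚ) * q) p q)

  -- Both sides are stable under adding multiples of x₀ and x₁. Condition (i), which normalises the
  -- linear part, is therefore imposed only in the decomposition.
  stab⇔ls : InStab ψ ⇔ (IsLieX ψ × Y.IsPrimitive (πY ψ) × OddDepth1Vanishing)
  stab⇔ls = mk⇔
    (λ (isLie , stab) → isLie , stab⇒primitive stab , primitiveD1⇒odd isLie (stab⇒primitiveD stab 1))
    (λ (isLie , primπ , odd) → isLie , primitive⇒stab primπ (primitiveD isLie primπ odd))

-- The linear part and the direct sum

linear : ℚ → ℚ → PolyX
linear a b = (a , [ x₀ ]) ∷ (b , [ x₁ ]) ∷ []

coef-linear : ∀ a b w → X.coef (linear a b) w ≡ a * δ X.wordEq w [ x₀ ] + (b * δ X.wordEq w [ x₁ ] + 0ℚ)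
coef-linear a b w = coeff-pair X.wordEq (linear a b) w

coef-lsSum : ∀ φ a b w → length w ≢ 1 → X.coef φ w ≡ X.coef (lsSum φ a b) w
coef-lsSum φ a b w l≢1 = sym (begin
  X.coef (lsSum φ a b) w                     ≡⟨ coeff-++ X.wordEq φ (linear a b) w ⟩
  X.coef φ w + X.coef (linear a b) w         ≡⟨ cong (X.coef φ w +_) (coef-linear a b w) ⟩
  X.coef φ w + (a * δ X.wordEq w [ x₀ ] + (b * δ X.wordEq w [ x₁ ] + 0ℚ))
    ≡⟨ cong₂ (λ p q → X.coef φ w + (a * p + (b * q + 0ℚ))) (δ-≢ X.wordEq w [ x₀ ] (λ { refl → l≢1 refl })) (δ-≢ X.wordEq w [ x₁ ] (λ { refl → l≢1 refl })) ⟩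
  X.coef φ w + (a * 0ℚ + (b * 0ℚ + 0ℚ))      ≡⟨ solve 3 (λ c a b → c :+ (a :* con 0ℚ :+ (b :* con 0ℚ :+ con 0ℚ)) := c) refl (X.coef φ w) a b ⟩
  X.coef φ w                                 ∎)

-- Only words of length other than one matter. For π_Y this rests on the fact that a word with at
-- least two letters in Y has at least two letters in X.
ls-conditions-cong : ∀ p q → (∀ w → length w ≢ 1 → X.coef p w ≡ X.coef q w) →
  IsLieX p × Y.IsPrimitive (πY p) × OddDepth1Vanishing p → IsLieX q × Y.IsPrimitive (πY q) × OddDepth1Vanishing q
ls-conditions-cong p q e (isLie , primπ , odd) =
  XP.primitive-cong p q e isLie ,
  YP.primitive-cong (πY p) (πY q) (λ w l≢1 → trans (coef-πY p w) (trans (e (ιword w) (length-ι≢1 w l≢1)) (sym (coef-πY q w)))) primπ ,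
  -- The case `k = 0` would be the letter x₁ itself; its weight 1 is odd, so the case is absurd.
  λ { (suc k) even → trans (sym (e (replicate (suc k) x₀ ∷ʳ x₁) (∷ʳ-long k))) (odd (suc k) even) }
  where
  ∷ʳ-long : ∀ k → length (replicate (suc k) x₀ ∷ʳ x₁) ≢ 1
  ∷ʳ-long zero    ()
  ∷ʳ-long (suc _) ()
  length-ι≢1 : ∀ w → length w ≢ 1 → length (ιword w) ≢ 1
  length-ι≢1 []          l≢1 ()
  length-ι≢1 (_ ∷ [])    l≢1 _ = l≢1 refl
  length-ι≢1 (a ∷ b ∷ w) l≢1 l
    with ℕP.m+n≡0⇒n≡0 a (ℕP.suc-injective (trans (sym (length-ι (a ∷ b ∷ w))) l))
  ... | ()

theorem1p16 : ((ψ : PolyX) → InStab ψ ⇔ (Σ[ φ ∈ PolyX ] Σ[ a ∈ ℚ ] Σ[ b ∈ ℚ ] (InLS φ × X._≈_ ψ (lsSum φ a b))))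
    × ((φ : PolyX) (a b : ℚ) → InLS φ → X._≈_ (lsSum φ a b) [] → X._≈_ φ [] × a ≡ 0ℚ × b ≡ 0ℚ)
theorem1p16 = (λ ψ → mk⇔ (to ψ) (from ψ)) , independent
  where
  to : ∀ ψ → InStab ψ → Σ[ φ ∈ PolyX ] Σ[ a ∈ ℚ ] Σ[ b ∈ ℚ ] (InLS φ × X._≈_ ψ (lsSum φ a b))
  to ψ stab = φ , a , b , (at-x₀ , at-x₁ , isLie , primπ , even) , ψ≈
    where
    a = X.coef ψ [ x₀ ]
    b = X.coef ψ [ x₁ ]
    φ = lsSum ψ (- a) (- b)
    conditions = ls-conditions-cong ψ φ (coef-lsSum ψ (- a) (- b)) (Equivalence.to (stab⇔ls ψ) stab)
    isLie = proj₁ conditions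
    primπ = proj₁ (proj₂ conditions)
    even : ∀ n → 2 ℕ.≤ n → n ℕ.% 2 ≡ 0 → X.coef φ (replicate (n ℕ.∸ 1) x₀ ++ x₁ ∷ []) ≡ 0ℚ
    even (suc k) _ e = proj₂ (proj₂ conditions) k e
    cancel : ∀ x → x + (- x + 0ℚ) ≡ 0ℚ
    cancel = solve 1 (λ x → x :+ (:- x :+ con 0ℚ) := con 0ℚ) refl
    at-x₀ : X.coef φ [ x₀ ] ≡ 0ℚ
    at-x₀ = trans (coeff-++ X.wordEq ψ (linear (- a) (- b)) [ x₀ ]) (cancel a)
    at-x₁ : X.coef φ [ x₁ ] ≡ 0ℚ
    at-x₁ = trans (coeff-++ X.wordEq ψ (linear (- a) (- b)) [ x₁ ]) (cancel b)
    ψ≈ : X._≈_ ψ (lsSum φ a b)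
    ψ≈ w = sym (begin
      X.coef (lsSum φ a b) w ≡⟨ coeff-++ X.wordEq φ (linear a b) w ⟩
      X.coef φ w + X.coef (linear a b) w
        ≡⟨ cong₂ _+_ (trans (coeff-++ X.wordEq ψ (linear (- a) (- b)) w) (cong (X.coef ψ w +_) (coef-linear (- a) (- b) w))) (coef-linear a b w) ⟩
      (X.coef ψ w + ((- a) * p + ((- b) * q + 0ℚ))) + (a * p + (b * q + 0ℚ))
        ≡⟨ solve 5 (λ c a b p q → (c :+ ((:- a) :* p :+ ((:- b) :* q :+ con 0ℚ))) :+ (a :* p :+ (b :* q :+ con 0ℚ)) := c) refl (X.coef ψ w) a b p q ⟩
      X.coef ψ w ∎)
      where
      p = δ X.wordEq w [ x₀ ]
      q = δ X.wordEq w [ x₁ ]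

  from : ∀ ψ → Σ[ φ ∈ PolyX ] Σ[ a ∈ ℚ ] Σ[ b ∈ ℚ ] (InLS φ × X._≈_ ψ (lsSum φ a b)) → InStab ψ
  from ψ (φ , a , b , (_ , _ , isLie , primπ , even) , ψ≈) = Equivalence.from (stab⇔ls ψ)
    (ls-conditions-cong φ ψ (λ w l≢1 → trans (coef-lsSum φ a b w l≢1) (sym (ψ≈ w))) (isLie , primπ , odd))
    where
    odd : OddDepth1Vanishing φ
    odd (suc k) e = even (suc (suc k)) (ℕ.s≤s (ℕ.s≤s ℕ.z≤n)) e

  -- By condition (i) the coefficients of x₀ and x₁ in the sum are exactly `a` and `b`; once these
  -- vanish, `φ` is the whole sum.
  independent : (φ : PolyX) (a b : ℚ) → InLS φ → X._≈_ (lsSum φ a b) [] → X._≈_ φ [] × a ≡ 0ℚ × b ≡ 0ℚ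
  independent φ a b (at-x₀ , at-x₁ , _) e = φ≈0 , a≡0 , b≡0
    where
    simplify : ∀ x → x ≡ 0ℚ + (x + 0ℚ)
    simplify = solve 1 (λ x → x := con 0ℚ :+ (x :+ con 0ℚ)) refl
    a≡0 : a ≡ 0ℚ
    a≡0 = trans (simplify a) (trans (cong (_+ (a + 0ℚ)) (sym at-x₀)) (trans (sym (coeff-++ X.wordEq φ (linear a b) [ x₀ ])) (e [ x₀ ])))
    b≡0 : b ≡ 0ℚ
    b≡0 = trans (simplify b) (trans (cong (_+ (b + 0ℚ)) (sym at-x₁)) (trans (sym (coeff-++ X.wordEq φ (linear a b) [ x₁ ])) (e [ x₁ ])))
    φ≈0 : X._≈_ φ []
    φ≈0 w = begin
      X.coef φ w                                  ≡⟨ solve 3 (λ c p q → c := c :+ (con 0ℚ :* p :+ (con 0ℚ :* q :+ con 0ℚ))) refl (X.coef φ w) p q ⟩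
      X.coef φ w + (0ℚ * p + (0ℚ * q + 0ℚ))       ≡⟨ cong₂ (λ a b → X.coef φ w + (a * p + (b * q + 0ℚ))) a≡0 b≡0 ⟨
      X.coef φ w + (a * p + (b * q + 0ℚ))         ≡⟨ cong (X.coef φ w +_) (coef-linear a b w) ⟨
      X.coef φ w + X.coef (linear a b) w          ≡⟨ coeff-++ X.wordEq φ (linear a b) w ⟨
      X.coef (lsSum φ a b) w                      ≡⟨ e w ⟩
      0ℚ                                          ∎
      where
      p = δ X.wordEq w [ x₀ ]
      q = δ X.wordEq w [ x₁ ]
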